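{- If $\mathrm{LCR}$ can be solved in $\mathcal{O}^*((2-\delta)^{\mathtt{C}})$ time for some $\delta>0$, then $\mathrm{Set\ Cover}$ can be solved in $\mathcal{O}^*((2-\delta)^{n})$ time.
   Context: $\mathcal{O}^*(f)$ suppresses factors polynomial in the input size. Set Cover. Input: a family of sets $\mathcal{F}\subseteq\mathcal{P}(U)$ over a finite universe $U$, and $r\in\mathbb{N}$. Question: are there sets $S_1,\dots,S_r$ in $\mathcal{F}$ such that $U=\bigcup_{i\in[1..r]}S_i$? Here $n=|U|$. Programs. A (shared memory) program is a tuple $\mathcal{A}=(D,a^0,(P_i)_{i\in[1..t]})$ with a finite data domain $D$, an initial memory value $a^0\in D$, and threads $P_i$. Let $\mathrm{Op}(D)=\{!a,?a \mid a\in D\}$ ($!a$ writes $a$ to the memory, $?a$ reads $a$ from it). Each thread is a nondeterministic finite automaton $P_i=(\mathrm{Op}(D),Q_i,q_i^0,\delta_i)$ with finite state set $Q_i$, initial state $q_i^0$ and transition relation $\delta_i\subseteq Q_i\times(\mathrm{Op}(D)\cup\{\varepsilon\})\times Q_i$. A configuration is a pair $(\mathit{pc},a)$ with $\mathit{pc}\in Q_1\times\dots\times Q_t$ and $a\in D$; the initial configuration is $c^0=((q_1^0,\dots,q_t^0),a^0)$. A step lets one thread $P_i$ take a transition from its current state $q$ to $q'$ (the other threads keep their states): a transition $(q,?a,q')$ is possible only if the memory holds $a$, and leaves the memory unchanged; a transition $(q,!b,q')$ is possible for any memory value and sets the memory to $b$; a transition $(q,\varepsilon,q')$ leaves the memory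 unchanged. Write $c\rightarrow^*_{\mathcal{A}}c'$ if $c'$ is reachable from $c$ by a finite sequence of steps. Leader Contributor Reachability ($\mathrm{LCR}$). Input: a program $\mathcal{A}=(D,a^0,(P_L,P_C))$ with two threads, the leader $P_L$ (state set $Q_L$) and the contributor $P_C$ (state set $Q_C$), and a set $F_L\subseteq Q_L$ of unsafe states. For $t\in\mathbb{N}$, let $\mathcal{A}^t=(D,a^0,(P_L,(P_C)_{i\in[1..t]}))$ be the program with one leader and exactly $t$ copies of $P_C$, and let $C^f$ be the set of configurations in which the leader is in a state of $F_L$. Question: is there a $t\in\mathbb{N}$ such that $c^0\rightarrow^*_{\mathcal{A}^t}c$ for some $c\in C^f$? Parameter: $\mathtt{C}=|Q_C|$. -}

module Defs where

open import Algebra.Bundles using (CommutativeRing; Semiring)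
import Algebra.Definitions.RawSemiring as RawSemiring
import Algebra.Properties.Group as GroupProperties
open import Data.Bool.Base using (Bool; true; false)
open import Data.Fin.Base using (Fin; zero; suc; toℕ)
open import Data.Fin.Subset using (Subset; ⋃) renaming (⊤ to full; _∈_ to _∈ₛ_)
open import Data.Integer.Base using (+_)
open import Data.List.Base using (List; []; _∷_; tabulate)
open import Data.List.Membership.Propositional using (_∈_)
open import Data.Maybe.Base using (Maybe; just; nothing)
open import Data.Nat.Base as ℕ using (ℕ; zero; suc)
open import Data.Nat.Binary.Base as ℕᵇ using (ℕᵇ; 2[1+_]; 1+[2_])
open import Data.Nat.Properties using () renaming (_≟_ to _≟ℕ_)
open import Data.Product using (Σ; ∃; ∃-syntax; _×_; _,_)
open import Data.Rational as ℚ using (ℚ; 0ℚ; _/_)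
open import Data.Rational.Properties as ℚₚ using (+-*-commutativeRing)
open import Data.Sum.Base using (_⊎_; inj₁; inj₂)
open import Data.Vec.Base using (toList)
open import Function.Bundles using (_⇔_)
open import Relation.Binary.Construct.Closure.ReflexiveTransitive using (Star)
open import Relation.Binary.PropositionalEquality
open import Relation.Nullary using (¬_; yes; no)

------------------------------------------------------------------------
-- Real numbers (two-sided Dedekind cuts)

record ℝ : Set₁ where
  field
    lower upper : ℚ → Set
    lower-inh   : ∃ lower
    upper-inh   : ∃ upper
    lower-down  : ∀ {p q} → p ℚ.< q → lower q → lower p
    lower-open  : ∀ {p} → lower p → ∃[ q ] p ℚ.< q × lower q
    upper-up    : ∀ {p q} → p ℚ.< q → upper p → upper q
    upper-open  : ∀ {q} → upper q → ∃[ p ] p ℚ.< q × upper p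
    disjoint    : ∀ {q} → ¬ (lower q × upper q)
    located     : ∀ {p q} → p ℚ.< q → lower p ⊎ upper q

infix 4 _<ʳ_ _ʳ<_

_<ʳ_ : ℚ → ℝ → Set
q <ʳ x = ℝ.lower x q

_ʳ<_ : ℝ → ℚ → Set
x ʳ< q = ℝ.upper x q

private
  r-[r-q]≡q : ∀ r q → r ℚ.- (r ℚ.- q) ≡ q
  r-[r-q]≡q r q = begin
    r ℚ.- (r ℚ.- q)                ≡⟨ cong (r ℚ.+_) (⁻¹-anti-homo‿- r q) ⟩
    r ℚ.+ (q ℚ.- r)                ≡⟨ ℚₚ.+-comm r (q ℚ.- r) ⟩
    (q ℚ.- r) ℚ.+ r                ≡⟨ ℚₚ.+-assoc q (ℚ.- r) r ⟩
    q ℚ.+ (ℚ.- r ℚ.+ r)            ≡⟨ cong (q ℚ.+_) (ℚₚ.+-inverseˡ r) ⟩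
    q ℚ.+ 0ℚ                       ≡⟨ ℚₚ.+-identityʳ q ⟩
    q                              ∎
    where
    open ≡-Reasoning
    ⁻¹-anti-homo‿- : ∀ x y → ℚ.- (x ℚ.- y) ≡ y ℚ.- x
    ⁻¹-anti-homo‿- x y = begin
      ℚ.- (x ℚ.+ ℚ.- y)            ≡⟨ ℚₚ.neg-distrib-+ x (ℚ.- y) ⟩
      ℚ.- x ℚ.+ ℚ.- (ℚ.- y)        ≡⟨ cong (ℚ.- x ℚ.+_) (⁻¹-involutive y) ⟩
      ℚ.- x ℚ.+ y                  ≡⟨ ℚₚ.+-comm (ℚ.- x) y ⟩
      y ℚ.- x                      ∎
      where
      open GroupProperties (CommutativeRing.+-group +-*-commutativeRing)
        using (⁻¹-involutive)

  r-mono : ∀ r {p q} → p ℚ.< q → r ℚ.- q ℚ.< r ℚ.- p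
  r-mono r p<q = ℚₚ.+-monoʳ-< r (ℚₚ.neg-antimono-< p<q)

infixl 6 _⊖_

_⊖_ : ℚ → ℝ → ℝ
r ⊖ x = record
  { lower      = λ q → x ʳ< (r ℚ.- q)
  ; upper      = λ q → (r ℚ.- q) <ʳ x
  ; lower-inh  = let (q , h) = upper-inh in r ℚ.- q , back upper h
  ; upper-inh  = let (q , h) = lower-inh in r ℚ.- q , back lower h
  ; lower-down = λ p<q → upper-up (r-mono r p<q)
  ; lower-open = λ {p} h → let (q , q<r-p , h′) = upper-open h in
                   r ℚ.- q
                 , subst (ℚ._< r ℚ.- q) (r-[r-q]≡q r p) (r-mono r q<r-p)
                 , back upper h′
  ; upper-up   = λ p<q → lower-down (r-mono r p<q)
  ; upper-open = λ {p} h → let (q , r-p<q , h′) = lower-open h in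
                   r ℚ.- q
                 , subst (r ℚ.- q ℚ.<_) (r-[r-q]≡q r p) (r-mono r r-p<q)
                 , back lower h′
  ; disjoint   = λ (u , l) → disjoint (l , u)
  ; located    = λ p<q → swap′ (located (r-mono r p<q))
  }
  where
  open ℝ x
  back : (P : ℚ → Set) → ∀ {q} → P q → P (r ℚ.- (r ℚ.- q))
  back P {q} = subst P (sym (r-[r-q]≡q r q))
  swap′ : ∀ {A B : Set} → A ⊎ B → B ⊎ A
  swap′ (inj₁ a) = inj₂ a
  swap′ (inj₂ b) = inj₁ b

_^ℚ_ : ℚ → ℕ → ℚ
_^ℚ_ = RawSemiring._^_ (Semiring.rawSemiring (CommutativeRing.semiring +-*-commutativeRing))

fromℕ : ℕ → ℚ
fromℕ n = + n / 1

2ℚ : ℚ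
2ℚ = fromℕ 2

-- The real inequality t ≤ m · βⁿ, for β ≥ 0.  Since b ↦ bⁿ is continuous and
-- monotone on b ≥ 0, it holds iff t ≤ m · bⁿ for every rational b > β.
-- (For negative β this reads βⁿ as 0ⁿ.)
_≤_·_^_ : ℕ → ℕ → ℝ → ℕ → Set
t ≤ m · β ^ n =
  ∀ (b : ℚ) → 0ℚ ℚ.≤ b → β ʳ< b → fromℕ t ℚ.≤ fromℕ m ℚ.* (b ^ℚ n)

------------------------------------------------------------------------
-- Computation: Jones' WHILE language over binary trees, with its usual
-- unit-cost time measure (every operator, assignment and test costs 1).
-- This is a pointer-machine model: up to factors polylogarithmic in the
-- running time it agrees with (logarithmic-cost) random access machines, so
-- the classes O*(βⁿ) do not depend on which of the two is used.  This would
-- fail for, e.g., single-tape Turing machines, which may square the time.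

infixr 5 _∙_

data Tree : Set where
  nil : Tree
  _∙_ : Tree → Tree → Tree

size : Tree → ℕ
size nil     = 1
size (s ∙ t) = suc (size s ℕ.+ size t)

hdᵗ tlᵗ : Tree → Tree
hdᵗ nil     = nil
hdᵗ (s ∙ _) = s
tlᵗ nil     = nil
tlᵗ (_ ∙ t) = t

Var : Set
Var = ℕ

data Expr : Set where
  var   : Var → Expr
  nil   : Expr
  cons  : Expr → Expr → Expr
  hd tl : Expr → Expr

infix  6 _:=_
infixr 5 _⨾_

data Cmd : Set where
  _:=_          : Var → Expr → Cmd
  _⨾_           : Cmd → Cmd → Cmd
  if_then_else_ : Expr → Cmd → Cmd → Cmd
  while_loop_    : Expr → Cmd → Cmd

Store : Set
Store = Var → Tree

_[_↦_] : Store → Var → Tree → Store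
(σ [ x ↦ t ]) y with y ≟ℕ x
... | yes _ = t
... | no  _ = σ y

⟦_⟧ : Expr → Store → Tree
⟦ var x ⟧    σ = σ x
⟦ nil ⟧      σ = nil
⟦ cons e f ⟧ σ = ⟦ e ⟧ σ ∙ ⟦ f ⟧ σ
⟦ hd e ⟧     σ = hdᵗ (⟦ e ⟧ σ)
⟦ tl e ⟧     σ = tlᵗ (⟦ e ⟧ σ)

cost : Expr → ℕ
cost (var _)    = 1
cost nil        = 1
cost (cons e f) = suc (cost e ℕ.+ cost f)
cost (hd e)     = suc (cost e)
cost (tl e)     = suc (cost e)

infix 4 ⟨_,_⟩⇓_In_

-- ⟨ c , σ ⟩⇓ τ In t : started in store σ, c terminates in store τ after
-- exactly t time units.  A test succeeds iff it evaluates to a non-nil tree.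
data ⟨_,_⟩⇓_In_ : Cmd → Store → Store → ℕ → Set where
  assign  : ∀ {x e σ} →
            ⟨ x := e , σ ⟩⇓ (σ [ x ↦ ⟦ e ⟧ σ ]) In suc (cost e)
  seq     : ∀ {c d σ τ υ s t} →
            ⟨ c , σ ⟩⇓ τ In s → ⟨ d , τ ⟩⇓ υ In t →
            ⟨ c ⨾ d , σ ⟩⇓ υ In s ℕ.+ t
  if-yes  : ∀ {e c d σ τ t} → ⟦ e ⟧ σ ≢ nil →
            ⟨ c , σ ⟩⇓ τ In t →
            ⟨ if e then c else d , σ ⟩⇓ τ In suc (cost e) ℕ.+ t
  if-no   : ∀ {e c d σ τ t} → ⟦ e ⟧ σ ≡ nil →
            ⟨ d , σ ⟩⇓ τ In t →
            ⟨ if e then c else d , σ ⟩⇓ τ In suc (cost e) ℕ.+ t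
  wh-step : ∀ {e c σ τ υ s t} → ⟦ e ⟧ σ ≢ nil →
            ⟨ c , σ ⟩⇓ τ In s → ⟨ while e loop c , τ ⟩⇓ υ In t →
            ⟨ while e loop c , σ ⟩⇓ υ In suc (cost e) ℕ.+ (s ℕ.+ t)
  wh-stop : ∀ {e c σ} → ⟦ e ⟧ σ ≡ nil →
            ⟨ while e loop c , σ ⟩⇓ σ In suc (cost e)

-- Variable 0 holds the input at the start and the answer at the end.
input : Tree → Store
input t = (λ _ → nil) [ 0 ↦ t ]

Accepts : Store → Set
Accepts σ = σ 0 ≢ nil

------------------------------------------------------------------------
-- Parameterized decision problems

record Problem : Set₁ where
  field
    Instance : Set
    encode   : Instance → Tree
    Yes      : Instance → Set
    param    : Instance → ℕ

-- Π can be solved in time O*(β ^ param).  A factor polynomial in the input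
-- size N is one bounded by c · (1 + N)ᵏ for some constants c and k.
SolvableInO* : Problem → ℝ → Set
SolvableInO* Π β =
  ∃[ prog ] ∃[ c ] ∃[ k ] ∀ (I : Instance) →
    ∃[ τ ] ∃[ t ]
      ⟨ prog , input (encode I) ⟩⇓ τ In t
      × (Accepts τ ⇔ Yes I)
      × t ≤ (c ℕ.* suc (size (encode I)) ℕ.^ k) · β ^ param I
  where open Problem Π

------------------------------------------------------------------------
-- Encodings

encodeℕ : ℕ → Tree
encodeℕ zero    = nil
encodeℕ (suc n) = nil ∙ encodeℕ n

-- Elements and cardinalities of finite sets (states, data values, universe)
-- are written in unary: as the sets count as part of the input, this changes
-- its size only polynomially.
encodeFin : ∀ {n} → Fin n → Tree
encodeFin i = encodeℕ (toℕ i)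

encodeBool : Bool → Tree
encodeBool false = nil
encodeBool true  = nil ∙ nil

encodeBin : ℕᵇ → Tree
encodeBin ℕᵇ.zero  = nil
encodeBin 2[1+ b ] = nil ∙ encodeBin b
encodeBin 1+[2 b ] = (nil ∙ nil) ∙ encodeBin b

encodeList : ∀ {A : Set} → (A → Tree) → List A → Tree
encodeList f []       = nil
encodeList f (x ∷ xs) = f x ∙ encodeList f xs

encodeSubset : ∀ {n} → Subset n → Tree
encodeSubset S = encodeList encodeBool (toList S)

------------------------------------------------------------------------
-- Set Cover

record SetCoverInstance : Set where
  field
    n : ℕ
    ℱ : List (Subset n)
    r : ℕ

-- The sets S₁, …, Sᵣ need not be distinct.
HasCover : SetCoverInstance → Set
HasCover I = Σ (Fin r → Subset n) λ S →
  (∀ i → S i ∈ ℱ) × full ≡ ⋃ (tabulate S)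
  where open SetCoverInstance I

-- The number r is written in binary.
encodeSetCover : SetCoverInstance → Tree
encodeSetCover I =
  encodeℕ n ∙ encodeList encodeSubset ℱ ∙ encodeBin (ℕᵇ.fromℕ r)
  where open SetCoverInstance I

SetCover : Problem
SetCover = record
  { Instance = SetCoverInstance
  ; encode   = encodeSetCover
  ; Yes      = HasCover
  ; param    = SetCoverInstance.n
  }

------------------------------------------------------------------------
-- Shared memory programs.  The finite sets D and Qᵢ are taken to be Fin d and
-- Fin ∣Q∣; a finite transition relation is given by listing its elements.

data Op (d : ℕ) : Set where
  !_ ¿_ : Fin d → Op d

-- ¿ a is the read ?a (the question mark is reserved); label nothing is ε.
Label : ℕ → Set
Label d = Maybe (Op d)

record NFA (d : ℕ) : Set where
  field
    ∣Q∣ : ℕ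
    q⁰  : Fin ∣Q∣
    δ   : List (Fin ∣Q∣ × Label d × Fin ∣Q∣)

record Program : Set where
  field
    d  : ℕ
    a⁰ : Fin d
    t  : ℕ
    P  : Fin t → NFA d

-- The label may be executed with the memory going from the first value to
-- the second.
data Effect {d : ℕ} : Label d → Fin d → Fin d → Set where
  read  : ∀ {a}   → Effect (just (¿ a)) a a
  write : ∀ {a b} → Effect (just (! b)) a b
  ε     : ∀ {a}   → Effect nothing a a

module Semantics (𝒜 : Program) where
  open Program 𝒜

  Config : Set
  Config = ((i : Fin t) → Fin (NFA.∣Q∣ (P i))) × Fin d

  c⁰ : Config
  c⁰ = (λ i → NFA.q⁰ (P i)) , a⁰

  data _⟶_ : Config → Config → Set where
    step : ∀ {pc pc′ a a′ o} (i : Fin t) →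
           (pc i , o , pc′ i) ∈ NFA.δ (P i) →
           Effect o a a′ →
           (∀ j → j ≢ i → pc′ j ≡ pc j) →
           (pc , a) ⟶ (pc′ , a′)

  _⟶*_ : Config → Config → Set
  _⟶*_ = Star _⟶_

------------------------------------------------------------------------
-- Leader contributor reachability

record LCRInstance : Set where
  field
    d   : ℕ
    a⁰  : Fin d
    P-L : NFA d
    P-C : NFA d
    F-L : Subset (NFA.∣Q∣ P-L)

-- One leader (thread 0) and t contributors.
_^^_ : LCRInstance → ℕ → Program
I ^^ t = record { d = d ; a⁰ = a⁰ ; t = suc t ; P = thread }
  where
  open LCRInstance I
  thread : Fin (suc t) → NFA d
  thread zero    = P-L
  thread (suc _) = P-C

C^f : (I : LCRInstance) (t : ℕ) → Semantics.Config (I ^^ t) → Set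
C^f I t (pc , _) = pc zero ∈ₛ LCRInstance.F-L I

ReachesC^f : LCRInstance → Set
ReachesC^f I =
  ∃[ t ] let open Semantics (I ^^ t) in
         ∃[ c ] c⁰ ⟶* c × C^f I t c

encodeLabel : ∀ {d} → Label d → Tree
encodeLabel nothing      = nil
encodeLabel (just (! a)) = nil ∙ encodeFin a
encodeLabel (just (¿ a)) = (nil ∙ nil) ∙ encodeFin a

encodeNFA : ∀ {d} → NFA d → Tree
encodeNFA A = encodeℕ ∣Q∣ ∙ encodeFin q⁰ ∙ encodeList encodeTransition δ
  where
  open NFA A
  encodeTransition : Fin ∣Q∣ × Label _ × Fin ∣Q∣ → Tree
  encodeTransition (q , o , q′) = encodeFin q ∙ encodeLabel o ∙ encodeFin q′

encodeLCR : LCRInstance → Tree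
encodeLCR I =
  encodeℕ d ∙ encodeFin a⁰ ∙ encodeNFA P-L ∙ encodeNFA P-C ∙ encodeSubset F-L
  where open LCRInstance I

-- The parameter is the number of contributor states.
LCR : Problem
LCR = record
  { Instance = LCRInstance
  ; encode   = encodeLCR
  ; Yes      = ReachesC^f
  ; param    = λ I → NFA.∣Q∣ (LCRInstance.P-C I)
  }

{-# OPTIONS --safe #-}

-- A Set Cover instance over n elements becomes an LCR instance whose
-- contributor has n + 1 states.  The leader writes the names of r sets; a
-- contributor that reads the name of S moves to the state of some u ∈ S, where
-- it can write u; finally the leader reads every element.  As r is given in
-- binary, it is first replaced by some m ≤ r with m = r or ∣ℱ∣ < m, which does
-- not affect the answer: once every member of ℱ can be chosen, further choices
-- are useless.  A WHILE program computes this instance in polynomial time s.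
-- An LCR run takes time t ≥ 1, so s + t ≤ (s + 1) · t, and hence the
-- polynomial overhead is absorbed even if the base 2 − δ were below 1.

module Submission where

open import Defs
open import Data.Bool.Base using (Bool; true; false) renaming (if_then_else_ to ifᵇ_then_else_)
open import Data.Empty using (⊥-elim)
open import Data.Fin.Base as Fin using (Fin; zero; suc; toℕ; _↑ˡ_; _↑ʳ_; inject₁)
import Data.Fin.Properties as Finₚ
open import Data.Fin.Subset using (Subset; ⋃) renaming (_∈_ to _∈ₛ_)
import Data.Fin.Subset.Properties as Subsetₚ
import Data.Integer.Base as ℤ
import Data.Integer.Properties as ℤₚ
open import Data.List.Base as List using (List; []; _∷_; length)
open import Data.List.Membership.Propositional using (_∈_)
open import Data.List.Membership.Propositional.Properties using (∈-lookup)
import Data.List.Relation.Unary.Any as Any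
import Data.List.Relation.Unary.Any.Properties as Anyₚ
open import Data.Maybe.Base using (just; nothing)
open import Data.Nat.Base as ℕ using (ℕ; zero; suc; _≤_; _<_; _+_; _*_; _∸_; _^_; _⊓_; _⊔_; z≤n; s≤s)
open import Data.Nat.Binary.Base as ℕᵇ using (ℕᵇ; 2[1+_]; 1+[2_])
import Data.Nat.Binary.Properties as ℕᵇₚ
import Data.Nat.Properties as ℕₚ
open import Data.Nat.Tactic.RingSolver using (solve-∀)
open import Data.Product using (∃-syntax; _×_; _,_; proj₁; proj₂)
open import Data.Rational as ℚ using (ℚ; 0ℚ; NonNegative; nonNegative)
import Data.Rational.Properties as ℚₚ
open import Data.Rational.Unnormalised.Base as ℚᵘ using (mkℚᵘ; *≡*; *≤*)
import Data.Rational.Unnormalised.Properties as ℚᵘₚ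
open import Data.Sum.Base as Sum using (_⊎_; inj₁; inj₂)
open import Data.Unit.Base using (⊤; tt)
open import Data.Vec.Base as Vec using (Vec; []; _∷_; here; toList)
import Data.Vec.Functional as Vector
import Data.Vec.Properties as Vecₚ
open import Function.Base using (_∘_; id; case_of_)
open import Function.Bundles using (_⇔_; mk⇔; Equivalence)
open import Function.Construct.Composition using (_⇔-∘_)
open import Function.Construct.Symmetry using (⇔-sym)
open import Relation.Binary.Construct.Closure.ReflexiveTransitive using (_◅_; _◅◅_) renaming (ε to done)
open import Relation.Binary.Definitions using (tri<; tri≈; tri>)
open import Relation.Binary.PropositionalEquality
open import Relation.Nullary using (yes; no)

-- The budget is tight: every contributor state beyond the n elements multiplies the time bound by a
-- further β, so only constantly many can be afforded. One is spent on the initial state, and the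
-- surplus β is paid for by a factor 2, as β < 2. All counting is therefore left to the leader,
-- whose size enters only polynomially: its countdown limits how many names are ever written and
-- fixes the order in which the elements are read.
--
-- Arbitrarily many contributors add no power, since an element gets into the memory only after some
-- contributor has read the name of a set containing it. Conversely n contributors suffice, one per
-- element.
--
-- The transition lists are built by folds over finite functions, in the very order in which the
-- WHILE program conses them. So at every point of a loop a register holds the encoding of a partial
-- fold, and no reordering has to be justified; the semantics needs only membership, which is
-- recovered from the folds separately.

-- Inequalities t ≤ m · βⁿ

toℚᵘ-fromℕ : ∀ n → ℚ.toℚᵘ (fromℕ n) ℚᵘ.≃ mkℚᵘ (ℤ.+ n) 0
toℚᵘ-fromℕ n = ℚₚ.toℚᵘ-fromℚᵘ (mkℚᵘ (ℤ.+ n) 0)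

fromℕ-mono-≤ : ∀ {m n} → m ≤ n → fromℕ m ℚ.≤ fromℕ n
fromℕ-mono-≤ {m} {n} m≤n = ℚₚ.toℚᵘ-cancel-≤ (begin
  ℚ.toℚᵘ (fromℕ m)  ≃⟨ toℚᵘ-fromℕ m ⟩
  mkℚᵘ (ℤ.+ m) 0    ≤⟨ *≤* (ℤₚ.*-monoʳ-≤-nonNeg (ℤ.+ 1) (ℤ.+≤+ m≤n)) ⟩
  mkℚᵘ (ℤ.+ n) 0    ≃⟨ toℚᵘ-fromℕ n ⟨
  ℚ.toℚᵘ (fromℕ n)  ∎)
  where open ℚᵘₚ.≤-Reasoning

fromℕ-homo-* : ∀ m n → fromℕ (m * n) ≡ fromℕ m ℚ.* fromℕ n
fromℕ-homo-* m n = ℚₚ.toℚᵘ-injective (begin-equality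
  ℚ.toℚᵘ (fromℕ (m * n))                    ≃⟨ toℚᵘ-fromℕ (m * n) ⟩
  mkℚᵘ (ℤ.+ (m * n)) 0                      ≃⟨ *≡* (cong (ℤ._* ℤ.+ 1) (ℤₚ.pos-* m n)) ⟩
  mkℚᵘ (ℤ.+ m) 0 ℚᵘ.* mkℚᵘ (ℤ.+ n) 0        ≃⟨ ℚᵘₚ.*-cong (toℚᵘ-fromℕ m) (toℚᵘ-fromℕ n) ⟨
  ℚ.toℚᵘ (fromℕ m) ℚᵘ.* ℚ.toℚᵘ (fromℕ n)    ≃⟨ ℚₚ.toℚᵘ-homo-* (fromℕ m) (fromℕ n) ⟨
  ℚ.toℚᵘ (fromℕ m ℚ.* fromℕ n)              ∎)
  where open ℚᵘₚ.≤-Reasoning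

fromℕ-nonNeg : ∀ n → NonNegative (fromℕ n)
fromℕ-nonNeg n = nonNegative (fromℕ-mono-≤ {0} {n} z≤n)

*-mono-≤-nonNeg : ∀ {p q r s} → 0ℚ ℚ.≤ q → 0ℚ ℚ.≤ r → p ℚ.≤ q → r ℚ.≤ s → p ℚ.* r ℚ.≤ q ℚ.* s
*-mono-≤-nonNeg {p} {q} {r} {s} 0≤q 0≤r p≤q r≤s = ℚₚ.≤-trans
  (ℚₚ.*-monoʳ-≤-nonNeg r {{nonNegative 0≤r}} p≤q)
  (ℚₚ.*-monoˡ-≤-nonNeg q {{nonNegative 0≤q}} r≤s)

^ℚ-nonNeg : ∀ {b} n → 0ℚ ℚ.≤ b → 0ℚ ℚ.≤ b ^ℚ n
^ℚ-nonNeg zero    0≤b = fromℕ-mono-≤ {0} {1} z≤n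
^ℚ-nonNeg {b} (suc n) 0≤b = subst (ℚ._≤ b ^ℚ suc n) (ℚₚ.*-zeroˡ 0ℚ)
  (*-mono-≤-nonNeg 0≤b ℚₚ.≤-refl 0≤b (^ℚ-nonNeg n 0≤b))

^ℚ-monoˡ-≤ : ∀ {a b} n → 0ℚ ℚ.≤ a → a ℚ.≤ b → a ^ℚ n ℚ.≤ b ^ℚ n
^ℚ-monoˡ-≤ zero    0≤a a≤b = ℚₚ.≤-refl
^ℚ-monoˡ-≤ (suc n) 0≤a a≤b =
  *-mono-≤-nonNeg (ℚₚ.≤-trans 0≤a a≤b) (^ℚ-nonNeg n 0≤a) a≤b (^ℚ-monoˡ-≤ n 0≤a a≤b)

-- A surplus factor b costs at most 2 if b ≤ 2; for b > 2 the hypothesis is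
-- used at 2 itself.
≤·^-pred : ∀ {t m β n} → β ʳ< 2ℚ → t ≤ m · β ^ suc n → t ≤ (m * 2) · β ^ n
≤·^-pred {t} {m} {β} {n} β<2 h b 0≤b β<b with ℚₚ.≤-total b 2ℚ
... | inj₁ b≤2 = begin
  fromℕ t                          ≤⟨ h b 0≤b β<b ⟩
  fromℕ m ℚ.* (b ℚ.* b ^ℚ n)       ≤⟨ ℚₚ.*-monoˡ-≤-nonNeg (fromℕ m) {{fromℕ-nonNeg m}}
                                        (ℚₚ.*-monoʳ-≤-nonNeg (b ^ℚ n) {{nonNegative (^ℚ-nonNeg n 0≤b)}} b≤2) ⟩
  fromℕ m ℚ.* (2ℚ ℚ.* b ^ℚ n)      ≡⟨ ℚₚ.*-assoc (fromℕ m) 2ℚ (b ^ℚ n) ⟨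
  fromℕ m ℚ.* 2ℚ ℚ.* b ^ℚ n        ≡⟨ cong (ℚ._* b ^ℚ n) (fromℕ-homo-* m 2) ⟨
  fromℕ (m * 2) ℚ.* b ^ℚ n         ∎
  where open ℚₚ.≤-Reasoning
... | inj₂ 2≤b = begin
  fromℕ t                          ≤⟨ h 2ℚ (fromℕ-mono-≤ {0} {2} z≤n) β<2 ⟩
  fromℕ m ℚ.* (2ℚ ℚ.* 2ℚ ^ℚ n)     ≡⟨ ℚₚ.*-assoc (fromℕ m) 2ℚ (2ℚ ^ℚ n) ⟨
  fromℕ m ℚ.* 2ℚ ℚ.* 2ℚ ^ℚ n       ≡⟨ cong (ℚ._* 2ℚ ^ℚ n) (fromℕ-homo-* m 2) ⟨
  fromℕ (m * 2) ℚ.* 2ℚ ^ℚ n        ≤⟨ ℚₚ.*-monoˡ-≤-nonNeg (fromℕ (m * 2)) {{fromℕ-nonNeg (m * 2)}}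
                                        (^ℚ-monoˡ-≤ n (fromℕ-mono-≤ {0} {2} z≤n) 2≤b) ⟩
  fromℕ (m * 2) ℚ.* b ^ℚ n         ∎
  where open ℚₚ.≤-Reasoning

≤·^-scale : ∀ {t m β n} k → t ≤ m · β ^ n → (k * t) ≤ (k * m) · β ^ n
≤·^-scale {t} {m} {β} {n} k h b 0≤b β<b = begin
  fromℕ (k * t)                     ≡⟨ fromℕ-homo-* k t ⟩
  fromℕ k ℚ.* fromℕ t               ≤⟨ ℚₚ.*-monoˡ-≤-nonNeg (fromℕ k) {{fromℕ-nonNeg k}} (h b 0≤b β<b) ⟩
  fromℕ k ℚ.* (fromℕ m ℚ.* b ^ℚ n)  ≡⟨ ℚₚ.*-assoc (fromℕ k) (fromℕ m) (b ^ℚ n) ⟨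
  fromℕ k ℚ.* fromℕ m ℚ.* b ^ℚ n    ≡⟨ cong (ℚ._* b ^ℚ n) (fromℕ-homo-* k m) ⟨
  fromℕ (k * m) ℚ.* b ^ℚ n          ∎
  where open ℚₚ.≤-Reasoning

≤·^-mono : ∀ {s t l m β n} → s ≤ t → l ≤ m → t ≤ l · β ^ n → s ≤ m · β ^ n
≤·^-mono {s} {t} {l} {m} {β} {n} s≤t l≤m h b 0≤b β<b = begin
  fromℕ s             ≤⟨ fromℕ-mono-≤ s≤t ⟩
  fromℕ t             ≤⟨ h b 0≤b β<b ⟩
  fromℕ l ℚ.* b ^ℚ n  ≤⟨ ℚₚ.*-monoʳ-≤-nonNeg (b ^ℚ n) {{nonNegative (^ℚ-nonNeg n 0≤b)}} (fromℕ-mono-≤ l≤m) ⟩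
  fromℕ m ℚ.* b ^ℚ n  ∎
  where open ℚₚ.≤-Reasoning

-- Executing WHILE programs on register lists

update-cong : ∀ {σ σ′ : Store} x {s t} → σ ≗ σ′ → s ≡ t → (σ [ x ↦ s ]) ≗ (σ′ [ x ↦ t ])
update-cong x σ≗σ′ s≡t y with y ℕₚ.≟ x
... | yes _ = s≡t
... | no  _ = σ≗σ′ y

⟦⟧-cong : ∀ e {σ σ′} → σ ≗ σ′ → ⟦ e ⟧ σ ≡ ⟦ e ⟧ σ′
⟦⟧-cong (var x)    σ≗σ′ = σ≗σ′ x
⟦⟧-cong nil        σ≗σ′ = refl
⟦⟧-cong (cons e f) σ≗σ′ = cong₂ _∙_ (⟦⟧-cong e σ≗σ′) (⟦⟧-cong f σ≗σ′)
⟦⟧-cong (hd e)     σ≗σ′ = cong hdᵗ (⟦⟧-cong e σ≗σ′)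
⟦⟧-cong (tl e)     σ≗σ′ = cong tlᵗ (⟦⟧-cong e σ≗σ′)

-- Stores are functions and there is no function extensionality, so programs
-- are only composed up to pointwise equality of stores.
⇓-cong : ∀ {c σ σ′ τ t} → σ ≗ σ′ → ⟨ c , σ ⟩⇓ τ In t →
         ∃[ τ′ ] ⟨ c , σ′ ⟩⇓ τ′ In t × τ ≗ τ′
⇓-cong {x := e} σ≗σ′ assign = _ , assign , update-cong x σ≗σ′ (⟦⟧-cong e σ≗σ′)
⇓-cong σ≗σ′ (seq p q) =
  let _ , p′ , τ≗ = ⇓-cong σ≗σ′ p
      _ , q′ , υ≗ = ⇓-cong τ≗ q
  in _ , seq p′ q′ , υ≗
⇓-cong {if e then _ else _} σ≗σ′ (if-yes e≢nil p) =
  let _ , p′ , τ≗ = ⇓-cong σ≗σ′ p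
  in _ , if-yes (e≢nil ∘ trans (⟦⟧-cong e σ≗σ′)) p′ , τ≗
⇓-cong {if e then _ else _} σ≗σ′ (if-no e≡nil p) =
  let _ , p′ , τ≗ = ⇓-cong σ≗σ′ p
  in _ , if-no (trans (sym (⟦⟧-cong e σ≗σ′)) e≡nil) p′ , τ≗
⇓-cong {while e loop _} σ≗σ′ (wh-step e≢nil p q) =
  let _ , p′ , τ≗ = ⇓-cong σ≗σ′ p
      _ , q′ , υ≗ = ⇓-cong τ≗ q
  in _ , wh-step (e≢nil ∘ trans (⟦⟧-cong e σ≗σ′)) p′ q′ , υ≗
⇓-cong {while e loop _} σ≗σ′ (wh-stop e≡nil) =
  _ , wh-stop (trans (sym (⟦⟧-cong e σ≗σ′)) e≡nil) , σ≗σ′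

⇓-positive : ∀ {c σ τ t} → ⟨ c , σ ⟩⇓ τ In t → 1 ≤ t
⇓-positive assign          = s≤s z≤n
⇓-positive (seq p _)       = ℕₚ.≤-trans (⇓-positive p) (ℕₚ.m≤m+n _ _)
⇓-positive (if-yes _ _)    = s≤s z≤n
⇓-positive (if-no _ _)     = s≤s z≤n
⇓-positive (wh-step _ _ _) = s≤s z≤n
⇓-positive (wh-stop _)     = s≤s z≤n

Regs : Set
Regs = List Tree

store : Regs → Store
store []      _       = nil
store (t ∷ _) zero    = t
store (_ ∷ ρ) (suc x) = store ρ x

set : Regs → Var → Tree → Regs
set []      zero    t = t ∷ []
set []      (suc x) t = nil ∷ set [] x t
set (_ ∷ ρ) zero    t = t ∷ ρ
set (s ∷ ρ) (suc x) t = s ∷ set ρ x t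

store-set-≡ : ∀ ρ x t → store (set ρ x t) x ≡ t
store-set-≡ []      zero    t = refl
store-set-≡ []      (suc x) t = store-set-≡ [] x t
store-set-≡ (_ ∷ ρ) zero    t = refl
store-set-≡ (_ ∷ ρ) (suc x) t = store-set-≡ ρ x t

store-set-≢ : ∀ ρ {x y} t → y ≢ x → store (set ρ x t) y ≡ store ρ y
store-set-≢ []      {zero}  {zero}  t y≢x = ⊥-elim (y≢x refl)
store-set-≢ []      {zero}  {suc y} t y≢x = refl
store-set-≢ []      {suc x} {zero}  t y≢x = refl
store-set-≢ []      {suc x} {suc y} t y≢x = store-set-≢ [] {x} {y} t (y≢x ∘ cong suc)
store-set-≢ (_ ∷ ρ) {zero}  {zero}  t y≢x = ⊥-elim (y≢x refl)
store-set-≢ (_ ∷ ρ) {zero}  {suc y} t y≢x = refl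
store-set-≢ (_ ∷ ρ) {suc x} {zero}  t y≢x = refl
store-set-≢ (_ ∷ ρ) {suc x} {suc y} t y≢x = store-set-≢ ρ {x} {y} t (y≢x ∘ cong suc)

store-set : ∀ ρ x t → (store ρ [ x ↦ t ]) ≗ store (set ρ x t)
store-set ρ x t y with y ℕₚ.≟ x
... | yes refl = sym (store-set-≡ ρ x t)
... | no  y≢x  = sym (store-set-≢ ρ t y≢x)

-- The time is bounded rather than exact, so that both branches of a conditional and all iterations
-- of a loop share one specification.
record Run (c : Cmd) (ρ ρ′ : Regs) (b : ℕ) : Set where
  constructor mkRun
  field
    {final}  : Store
    {time}   : ℕ
    exec     : ⟨ c , store ρ ⟩⇓ final In time
    final-≗  : final ≗ store ρ′
    time-≤   : time ≤ b

run-assign : ∀ {x e ρ} → Run (x := e) ρ (set ρ x (⟦ e ⟧ (store ρ))) (suc (cost e))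
run-assign {x} {e} {ρ} = mkRun assign (store-set ρ x _) ℕₚ.≤-refl

infixr 5 _▸_

_▸_ : ∀ {c d ρ ρ′ ρ″ a b} → Run c ρ ρ′ a → Run d ρ′ ρ″ b → Run (c ⨾ d) ρ ρ″ (a + b)
(mkRun p τ≗ s≤a) ▸ (mkRun q υ≗ t≤b) =
  let _ , q′ , υ≗υ′ = ⇓-cong (sym ∘ τ≗) q
  in mkRun (seq p q′) (λ x → trans (sym (υ≗υ′ x)) (υ≗ x)) (ℕₚ.+-mono-≤ s≤a t≤b)

-- Time bound for commands without loops; a loop counts as one failed test.
straight : Cmd → ℕ
straight (x := e)             = suc (cost e)
straight (c ⨾ d)              = straight c + straight d
straight (if e then c else d) = suc (cost e) + (straight c ⊔ straight d)
straight (while e loop c)     = suc (cost e)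

run-then : ∀ {e c d ρ ρ′} → ⟦ e ⟧ (store ρ) ≢ nil → Run c ρ ρ′ (straight c) →
           Run (if e then c else d) ρ ρ′ (straight (if e then c else d))
run-then {e} {c} {d} e≢nil (mkRun p τ≗ t≤) = mkRun (if-yes e≢nil p) τ≗
  (ℕₚ.+-monoʳ-≤ (suc (cost e)) (ℕₚ.≤-trans t≤ (ℕₚ.m≤m⊔n (straight c) (straight d))))

run-else : ∀ {e c d ρ ρ′} → ⟦ e ⟧ (store ρ) ≡ nil → Run d ρ ρ′ (straight d) →
           Run (if e then c else d) ρ ρ′ (straight (if e then c else d))
run-else {e} {c} {d} e≡nil (mkRun p τ≗ t≤) = mkRun (if-no e≡nil p) τ≗
  (ℕₚ.+-monoʳ-≤ (suc (cost e)) (ℕₚ.≤-trans t≤ (ℕₚ.m≤n⊔m (straight c) (straight d))))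

run-stop : ∀ {e c ρ} → ⟦ e ⟧ (store ρ) ≡ nil → Run (while e loop c) ρ ρ (suc (cost e))
run-stop e≡nil = mkRun (wh-stop e≡nil) (λ _ → refl) ℕₚ.≤-refl

run-step : ∀ {e c ρ ρ′ ρ″ a b} → ⟦ e ⟧ (store ρ) ≢ nil → Run c ρ ρ′ a →
           Run (while e loop c) ρ′ ρ″ b →
           Run (while e loop c) ρ ρ″ (suc (cost e) + (a + b))
run-step {e} e≢nil (mkRun p τ≗ s≤a) (mkRun q υ≗ t≤b) =
  let _ , q′ , υ≗υ′ = ⇓-cong (sym ∘ τ≗) q
  in mkRun (wh-step e≢nil p q′) (λ x → trans (sym (υ≗υ′ x)) (υ≗ x))
       (ℕₚ.+-monoʳ-≤ (suc (cost e)) (ℕₚ.+-mono-≤ s≤a t≤b))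

run-weaken : ∀ {c ρ ρ′ a b} → a ≤ b → Run c ρ ρ′ a → Run c ρ ρ′ b
run-weaken a≤b (mkRun p τ≗ t≤a) = mkRun p τ≗ (ℕₚ.≤-trans t≤a a≤b)

-- The function with index 0 acts first, as in a loop. If every function conses an entry, the last
-- index ends up in front, just as in the tree that the loop builds.
applyAll : ∀ {S : Set} {m} → (Fin m → S → S) → S → S
applyAll g s = Vector.foldl (λ s h → h s) s g

-- The constant 2 is the cost of testing a variable: m tests succeed and one fails.
loopTime : ℕ → ℕ → ℕ
loopTime m b = 2 + m * (2 + b)

loopTime-suc : ∀ m b → 2 + (b + loopTime m b) ≡ loopTime (suc m) b
loopTime-suc m b = cong (2 +_) (trans (ℕₚ.+-suc b _) (cong suc (ℕₚ.+-suc b _)))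

cons≢nil : ∀ {s t} → s ∙ t ≢ nil
cons≢nil ()

-- R c k s lists the registers when c is left of the list to be traversed, k
-- elements have been visited and the accumulated state is s.
run-loop : ∀ {A S : Set} {m x body b} {f : A → Tree} (v : Vec A m)
           (R : Tree → ℕ → S → Regs) (g : Fin m → S → S) →
           (∀ c k s → store (R c k s) x ≡ c) →
           (∀ i c s → Run body (R (f (Vec.lookup v i) ∙ c) (toℕ i) s) (R c (suc (toℕ i)) (g i s)) b) →
           ∀ s → Run (while var x loop body) (R (encodeList f (toList v)) 0 s)
                     (R nil m (applyAll g s)) (loopTime m b)
run-loop []       R g test step s = run-stop (test nil 0 s)
run-loop {m = suc m} {b = b} (a ∷ v) R g test step s =
  run-weaken (ℕₚ.≤-reflexive (loopTime-suc m b))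
    (run-step (λ e → cons≢nil (trans (sym (test _ 0 s)) e)) (step zero _ s)
      (run-loop v (λ c k → R c (suc k)) (g ∘ suc) (λ c k → test c (suc k))
        (λ i c → step (suc i) c) (g zero s)))

-- Covers and the number of stages

-- Sets are chosen by index, since indices are what the leader announces, and each element comes
-- with a stage that covers it, since that stage tells a contributor when to read.
record Cover {n K} (S : Fin K → Subset n) (m : ℕ) : Set where
  constructor cover
  field
    choice : Fin m → Fin K
    covers : ∀ u → ∃[ i ] u ∈ₛ S (choice i)

∈-⋃-tabulate⁺ : ∀ {n m} (S : Fin m → Subset n) {u} i → u ∈ₛ S i → u ∈ₛ ⋃ (List.tabulate S)
∈-⋃-tabulate⁺ S zero    u∈ = Subsetₚ.x∈p∪q⁺ (inj₁ u∈)
∈-⋃-tabulate⁺ S (suc i) u∈ = Subsetₚ.x∈p∪q⁺ (inj₂ (∈-⋃-tabulate⁺ (S ∘ suc) i u∈))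

∈-⋃-tabulate⁻ : ∀ {n m} (S : Fin m → Subset n) {u} → u ∈ₛ ⋃ (List.tabulate S) → ∃[ i ] u ∈ₛ S i
∈-⋃-tabulate⁻ {m = zero}  S u∈ = ⊥-elim (Subsetₚ.∉⊥ u∈)
∈-⋃-tabulate⁻ {m = suc m} S u∈ with Subsetₚ.x∈p∪q⁻ (S zero) (⋃ (List.tabulate (S ∘ suc))) u∈
... | inj₁ p = zero , p
... | inj₂ p = let i , q = ∈-⋃-tabulate⁻ (S ∘ suc) p in suc i , q

hasCover⇔cover : ∀ I → let open SetCoverInstance I in HasCover I ⇔ Cover (List.lookup ℱ) r
hasCover⇔cover I = mk⇔ to from
  where
  open SetCoverInstance I
  to : HasCover I → Cover (List.lookup ℱ) r
  to (S , S∈ , eq) = cover (λ i → Any.index (S∈ i)) λ u →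
    let i , u∈ = ∈-⋃-tabulate⁻ S (subst (u ∈ₛ_) eq Subsetₚ.∈⊤)
    in i , subst (u ∈ₛ_) (Anyₚ.lookup-index (S∈ i)) u∈
  from : Cover (List.lookup ℱ) r → HasCover I
  from (cover js cov) = List.lookup ℱ ∘ js , (λ i → ∈-lookup {xs = ℱ} (js i)) ,
    Subsetₚ.⊆-antisym
      (λ {u} _ → let i , u∈ = cov u in ∈-⋃-tabulate⁺ (List.lookup ℱ ∘ js) i u∈)
      (Subsetₚ.⊆-max _)

-- Surplus stages repeat the choice of stage 0. This is where `1 ≤ k` enters: an empty choice offers
-- nothing to repeat.
cover-mono : ∀ {n K k m} {S : Fin K → Subset n} → 1 ≤ k → k ≤ m → Cover S k → Cover S m
cover-mono {k = suc k} {S = S} _ k≤m (cover js cov) =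
  cover (js ∘ clamp) λ u → let i , u∈ = cov u in
    Fin.inject≤ i k≤m , subst (λ i → u ∈ₛ S (js i)) (sym (clamp-inject≤ i)) u∈
  where
  clamp : Fin _ → Fin (suc k)
  clamp i with toℕ i ℕₚ.<? suc k
  ... | yes i<k = Fin.fromℕ< i<k
  ... | no  _   = zero
  clamp-inject≤ : ∀ i → clamp (Fin.inject≤ i k≤m) ≡ i
  clamp-inject≤ i with toℕ (Fin.inject≤ i k≤m) ℕₚ.<? suc k
  ... | yes p = Finₚ.toℕ-injective (trans (Finₚ.toℕ-fromℕ< p) (Finₚ.toℕ-inject≤ i k≤m))
  ... | no ¬p = ⊥-elim (¬p (subst (_< suc k) (sym (Finₚ.toℕ-inject≤ i k≤m)) (Finₚ.toℕ<n i)))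

-- With more than K stages every member can be chosen, so the identity choice is as good as any. The
-- inequality `K < m` is strict because of the empty family: over an empty universe it has a cover
-- with 0 choices but none with a positive number, so m must not drop to 0.
cover-cap : ∀ {n K k m} {S : Fin K → Subset n} → m ≤ k → K < m → Cover S k ⇔ Cover S m
cover-cap {K = zero} {suc k} {suc m} m≤k K<m =
  mk⇔ (λ c → ⊥-elim (Finₚ.¬Fin0 (Cover.choice c zero))) (cover-mono (s≤s z≤n) m≤k)
cover-cap {K = suc K} {k} {m} {S} m≤k K<m =
  mk⇔ (λ (cover js cov) → cover-mono (s≤s z≤n) (ℕₚ.<⇒≤ K<m)
                            (cover id λ u → let i , u∈ = cov u in js i , u∈))
      (cover-mono (ℕₚ.≤-trans (s≤s z≤n) K<m) m≤k)

-- The weight of a digit is capped at p + g: capSum b 1 g 0 is the sum of the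
-- dᵢ · min(2ⁱ, 1 + g), where the dᵢ ∈ {1, 2} are the digits of b.
capSum : ℕᵇ → ℕ → ℕ → ℕ → ℕ
capSum ℕᵇ.zero  p g s = s
capSum 2[1+ b ] p g s = capSum b (p + p ⊓ g) (g ∸ p) (p * 2 + s)
capSum 1+[2 b ] p g s = capSum b (p + p ⊓ g) (g ∸ p) (p * 1 + s)

cap-invariant : ∀ p g → (p + p ⊓ g) + (g ∸ p) ≡ p + g
cap-invariant p g = trans (ℕₚ.+-assoc p (p ⊓ g) (g ∸ p)) (cong (p +_) (ℕₚ.m⊓n+n∸m≡n p g))

p+p⊓g≤2p : ∀ p g → p + p ⊓ g ≤ p + p
p+p⊓g≤2p p g = ℕₚ.+-monoʳ-≤ p (ℕₚ.m⊓n≤m p g)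

-- From one digit to the next the capped weight at most doubles, so it never exceeds the true
-- weight.
capSum≤ : ∀ b p g s → capSum b p g s ≤ p * ℕᵇ.toℕ b + s
capSum≤ ℕᵇ.zero  p g s = ℕₚ.m≤n+m s (p * 0)
capSum≤ 2[1+ b ] p g s = ℕₚ.≤-trans (capSum≤ b _ _ _)
  (ℕₚ.≤-trans (ℕₚ.+-monoˡ-≤ (p * 2 + s) (ℕₚ.*-monoˡ-≤ (ℕᵇ.toℕ b) (p+p⊓g≤2p p g)))
    (ℕₚ.≤-reflexive (rearrange p (ℕᵇ.toℕ b) s)))
  where
  rearrange : ∀ p b s → (p + p) * b + (p * 2 + s) ≡ p * (2 * (1 + b)) + s
  rearrange = solve-∀
capSum≤ 1+[2 b ] p g s = ℕₚ.≤-trans (capSum≤ b _ _ _)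
  (ℕₚ.≤-trans (ℕₚ.+-monoˡ-≤ (p * 1 + s) (ℕₚ.*-monoˡ-≤ (ℕᵇ.toℕ b) (p+p⊓g≤2p p g)))
    (ℕₚ.≤-reflexive (rearrange p (ℕᵇ.toℕ b) s)))
  where
  rearrange : ∀ p b s → (p + p) * b + (p * 1 + s) ≡ p * (1 + 2 * b) + s
  rearrange = solve-∀

-- Here d is the current digit and x the value of the digits above it. If `p ≤ g`, the weight
-- doubles exactly. Otherwise the next weight is the whole cap `p + g`: a positive x then
-- contributes at least the cap, and for x = 0 the weight is irrelevant.
capSum-exact-step : ∀ {t} p g d x s →
  t ≡ (p + p ⊓ g) * x + (p * d + s) ⊎ (p + p ⊓ g) + (g ∸ p) ≤ t →
  t ≡ p * (d + 2 * x) + s ⊎ p + g ≤ t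
capSum-exact-step {t} p g d x s (inj₂ le) = inj₂ (subst (_≤ t) (cap-invariant p g) le)
capSum-exact-step p g d x s (inj₁ eq) with ℕₚ.≤-total p g
... | inj₁ p≤g rewrite ℕₚ.m≤n⇒m⊓n≡m p≤g = inj₁ (trans eq (rearrange p d x s))
  where
  rearrange : ∀ p d x s → (p + p) * x + (p * d + s) ≡ p * (d + 2 * x) + s
  rearrange = solve-∀
capSum-exact-step p g d zero s (inj₁ eq) | inj₂ g≤p =
  inj₁ (trans eq (rearrange p (p ⊓ g) d s))
  where
  rearrange : ∀ p q d s → (p + q) * 0 + (p * d + s) ≡ p * (d + 0) + s
  rearrange = solve-∀
capSum-exact-step p g d (suc x) s (inj₁ eq) | inj₂ g≤p rewrite ℕₚ.m≥n⇒m⊓n≡n g≤p =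
  inj₂ (subst (p + g ≤_) (sym eq)
    (ℕₚ.≤-trans (ℕₚ.m≤m*n (p + g) (suc x)) (ℕₚ.m≤m+n _ (p * d + s))))

capSum-exact : ∀ b p g s → capSum b p g s ≡ p * ℕᵇ.toℕ b + s ⊎ p + g ≤ capSum b p g s
capSum-exact ℕᵇ.zero  p g s = inj₁ (cong (_+ s) (sym (ℕₚ.*-zeroʳ p)))
capSum-exact 2[1+ b ] p g s =
  subst (λ y → capSum 2[1+ b ] p g s ≡ p * y + s ⊎ p + g ≤ capSum 2[1+ b ] p g s)
    (sym (ℕₚ.*-suc 2 (ℕᵇ.toℕ b)))
    (capSum-exact-step p g 2 (ℕᵇ.toℕ b) s (capSum-exact b (p + p ⊓ g) (g ∸ p) _))
capSum-exact 1+[2 b ] p g s = capSum-exact-step p g 1 (ℕᵇ.toℕ b) s (capSum-exact b (p + p ⊓ g) (g ∸ p) _)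

capSum≤size-step : ∀ {t} p g d x s → d ≤ 2 →
  t ≤ x * (((p + p ⊓ g) + (g ∸ p)) * 2) + (p * d + s) →
  t ≤ suc x * ((p + g) * 2) + s
capSum≤size-step {t} p g d x s d≤2 t≤ = begin
  t                                                     ≤⟨ t≤ ⟩
  x * (((p + p ⊓ g) + (g ∸ p)) * 2) + (p * d + s)       ≡⟨ cong (λ y → x * (y * 2) + (p * d + s)) (cap-invariant p g) ⟩
  x * ((p + g) * 2) + (p * d + s)                       ≤⟨ ℕₚ.+-monoʳ-≤ (x * ((p + g) * 2))
                                                               (ℕₚ.+-monoˡ-≤ s (ℕₚ.*-mono-≤ (ℕₚ.m≤m+n p g) d≤2)) ⟩
  x * ((p + g) * 2) + ((p + g) * 2 + s)                 ≡⟨ rearrange (x * ((p + g) * 2)) ((p + g) * 2) s ⟩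
  suc x * ((p + g) * 2) + s                             ∎
  where
  open ℕₚ.≤-Reasoning
  rearrange : ∀ a b c → a + (b + c) ≡ b + a + c
  rearrange = solve-∀

-- Each digit is at most 2 and its weight at most `p + g`. This makes the number of stages
-- polynomial although r may be exponential in the input size.
capSum≤size : ∀ b p g s → capSum b p g s ≤ ℕᵇ.size b * ((p + g) * 2) + s
capSum≤size ℕᵇ.zero  p g s = ℕₚ.≤-refl
capSum≤size 2[1+ b ] p g s = capSum≤size-step p g 2 (ℕᵇ.size b) s ℕₚ.≤-refl (capSum≤size b _ _ _)
capSum≤size 1+[2 b ] p g s = capSum≤size-step p g 1 (ℕᵇ.size b) s (s≤s z≤n) (capSum≤size b _ _ _)

-- Weight 1 and room K put the cap at 1 + K, so a sum that differs from r is larger than K.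
cap : ℕ → ℕ → ℕ
cap r K = capSum (ℕᵇ.fromℕ r) 1 K 0

1*toℕ-fromℕ : ∀ r → 1 * ℕᵇ.toℕ (ℕᵇ.fromℕ r) + 0 ≡ r
1*toℕ-fromℕ r = trans (ℕₚ.+-identityʳ _) (trans (ℕₚ.*-identityˡ _) (ℕᵇₚ.toℕ-fromℕ r))

cover⇔cover-cap : ∀ {n K} {S : Fin K → Subset n} r → Cover S r ⇔ Cover S (cap r K)
cover⇔cover-cap {K = K} {S} r with capSum-exact (ℕᵇ.fromℕ r) 1 K 0
... | inj₁ eq = subst (λ m → Cover S r ⇔ Cover S m) (sym (trans eq (1*toℕ-fromℕ r))) (mk⇔ id id)
... | inj₂ K<cap = cover-cap (subst (cap r K ≤_) (1*toℕ-fromℕ r) (capSum≤ (ℕᵇ.fromℕ r) 1 K 0)) K<cap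

-- The LCR instance of a family of sets

-- Describes an inserting function instead of a finished list, so that descriptions compose along
-- the nested folds that build the transition lists.
Inserts : ∀ {X : Set} → (X → Set) → (List X → List X) → Set
Inserts P h = ∀ {x acc} → x ∈ h acc ⇔ (P x ⊎ x ∈ acc)

inserts-∷ : ∀ {X : Set} {y : X} → Inserts (_≡ y) (y ∷_)
inserts-∷ = mk⇔ (λ { (Any.here e) → inj₁ e ; (Any.there p) → inj₂ p })
                (λ { (inj₁ e) → Any.here e ; (inj₂ p) → Any.there p })

inserts-if : ∀ {X : Set} {b} {P : X → Set} {h} → Inserts P h →
             Inserts (λ x → b ≡ true × P x) (ifᵇ b then h else id)
inserts-if {b = true}  ins = mk⇔ (Sum.map₁ (refl ,_) ∘ Equivalence.to ins)
                                 (Equivalence.from ins ∘ Sum.map₁ proj₂)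
inserts-if {b = false} ins = mk⇔ inj₂ λ { (inj₁ (() , _)) ; (inj₂ q) → q }

inserts-applyAll : ∀ {X : Set} {m} {P : Fin m → X → Set} {g} → (∀ i → Inserts (P i) (g i)) →
                   Inserts (λ x → ∃[ i ] P i x) (applyAll g)
inserts-applyAll {m = zero} ins = mk⇔ inj₂ λ { (inj₁ (() , _)) ; (inj₂ q) → q }
inserts-applyAll {m = suc m} {P} {g} ins {x} {acc} = mk⇔ to from
  where
  module Rest = Equivalence (inserts-applyAll {P = P ∘ suc} (ins ∘ suc) {x} {g zero acc})
  module Head = Equivalence (ins zero {x} {acc})
  to : x ∈ applyAll g acc → (∃[ i ] P i x) ⊎ x ∈ acc
  to p with Rest.to p
  ... | inj₁ (i , q) = inj₁ (suc i , q)
  ... | inj₂ q with Head.to q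
  ...   | inj₁ r = inj₁ (zero , r)
  ...   | inj₂ r = inj₂ r
  from : (∃[ i ] P i x) ⊎ x ∈ acc → x ∈ applyAll g acc
  from (inj₁ (suc i , q)) = Rest.from (inj₁ (i , q))
  from (inj₁ (zero , q))  = Rest.from (inj₂ (Head.from (inj₁ q)))
  from (inj₂ q)           = Rest.from (inj₂ (Head.from (inj₂ q)))

↑ˡ≢↑ʳ : ∀ {m n} (i : Fin m) (j : Fin n) → i ↑ˡ n ≢ m ↑ʳ j
↑ˡ≢↑ʳ {m} {n} i j eq with
  trans (sym (Finₚ.splitAt-↑ˡ m i n)) (trans (cong (Fin.splitAt m) eq) (Finₚ.splitAt-↑ʳ m n j))
... | ()

module _ {n K : ℕ} where

  -- Value zero, the initial one, is neither an element nor the name of a set.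
  Value : Set
  Value = Fin (suc (n + K))

  elem : Fin n → Value
  elem u = suc (u ↑ˡ K)

  name : Fin K → Value
  name j = suc (n ↑ʳ j)

  elem-injective : ∀ {u v} → elem u ≡ elem v → u ≡ v
  elem-injective {u} {v} e = Finₚ.↑ˡ-injective K u v (Finₚ.suc-injective e)

  name-injective : ∀ {i j} → name i ≡ name j → i ≡ j
  name-injective {i} {j} e = Finₚ.↑ʳ-injective n i j (Finₚ.suc-injective e)

  elem≢name : ∀ {u j} → elem u ≢ name j
  elem≢name {u} {j} e = ↑ˡ≢↑ʳ u j (Finₚ.suc-injective e)

  Transition : ℕ → Set
  Transition q = Fin q × Label (suc (n + K)) × Fin q

  module _ (m : ℕ) where

    LTrans : Set
    LTrans = Transition (suc (n + m))

    await : Fin n → LTrans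
    await u = suc (u ↑ˡ m) , just (¿ elem u) , inject₁ (u ↑ˡ m)

    announce : Fin m → Fin K → LTrans
    announce i j = suc (n ↑ʳ i) , just (! name j) , inject₁ (n ↑ʳ i)

    leaderδ : List LTrans
    leaderδ = applyAll (λ i → applyAll (λ j → announce i j ∷_)) (applyAll (λ u → await u ∷_) [])

    ∈-leaderδ : ∀ {x} → x ∈ leaderδ ⇔ ((∃[ i ] ∃[ j ] x ≡ announce i j) ⊎ (∃[ u ] x ≡ await u) ⊎ x ∈ [])
    ∈-leaderδ = mk⇔
      (Sum.map₂ (Equivalence.to elems) ∘ Equivalence.to stages)
      (Equivalence.from stages ∘ Sum.map₂ (Equivalence.from elems))
      where
      elems : Inserts (λ x → ∃[ u ] x ≡ await u) _
      elems = inserts-applyAll (λ u → inserts-∷)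
      stages : Inserts (λ x → ∃[ i ] ∃[ j ] x ≡ announce i j) _
      stages = inserts-applyAll (λ i → inserts-applyAll (λ j → inserts-∷))

    -- The leader counts down.  While its state is n + i + 1 it still has i + 1
    -- sets to announce; below that, in state u + 1, it waits for element u.
    leader : NFA (suc (n + K))
    leader = record { ∣Q∣ = suc (n + m) ; q⁰ = Fin.fromℕ (n + m) ; δ = leaderδ }

  module _ (S : Fin K → Subset n) where

    CTrans : Set
    CTrans = Transition (suc n)

    -- A self-loop, because a separate state for having written would cost a further contributor
    -- state.
    report : Fin n → CTrans
    report u = suc u , just (! elem u) , suc u

    pick : Fin K → Fin n → CTrans
    pick j u = zero , just (¿ name j) , suc u

    contributorδ : List CTrans
    contributorδ =
      applyAll (λ j → applyAll (λ u → ifᵇ Vec.lookup (S j) u then pick j u ∷_ else id))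
        (applyAll (λ u → report u ∷_) [])

    ∈-contributorδ : ∀ {x} → x ∈ contributorδ ⇔
      ((∃[ j ] ∃[ u ] Vec.lookup (S j) u ≡ true × x ≡ pick j u) ⊎ (∃[ u ] x ≡ report u) ⊎ x ∈ [])
    ∈-contributorδ = mk⇔
      (Sum.map₂ (Equivalence.to reports) ∘ Equivalence.to picks)
      (Equivalence.from picks ∘ Sum.map₂ (Equivalence.from reports))
      where
      reports : Inserts (λ x → ∃[ u ] x ≡ report u) _
      reports = inserts-applyAll (λ u → inserts-∷)
      picks : Inserts (λ x → ∃[ j ] ∃[ u ] Vec.lookup (S j) u ≡ true × x ≡ pick j u) _
      picks = inserts-applyAll (λ j → inserts-applyAll (λ u → inserts-if {b = Vec.lookup (S j) u} inserts-∷))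

    contributor : NFA (suc (n + K))
    contributor = record { ∣Q∣ = suc n ; q⁰ = zero ; δ = contributorδ }

    coverLCR : ℕ → LCRInstance
    coverLCR m = record
      { d   = suc (n + K)
      ; a⁰  = zero
      ; P-L = leader m
      ; P-C = contributor
      ; F-L = true ∷ Vec.replicate (n + m) false
      }

-- Runs of the LCR instance correspond to covers

module _ {n K : ℕ} (S : Fin K → Subset n) (m : ℕ) where

  lcr : LCRInstance
  lcr = coverLCR S m

  CoveredBy : List (Fin K) → Fin n → Set
  CoveredBy W u = ∃[ j ] j ∈ W × u ∈ₛ S j

  coveredBy-∷ : ∀ {W u} j → CoveredBy W u → CoveredBy (j ∷ W) u
  coveredBy-∷ j (j′ , j′∈ , u∈) = j′ , Any.there j′∈ , u∈

  module Soundness (t : ℕ) where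
    open Semantics (lcr ^^ t)

    -- W is a ghost history of the announced sets, newest first. By truncated subtraction
    -- `toℕ (pc zero) ∸ n` is the number of announcements to come, and 0 while the leader waits for
    -- elements. Every element held, displayed or already read by the leader is traced back to W; as
    -- W only grows, the number of contributors is irrelevant.
    record Inv (c : Config) : Set where
      private
        pc = proj₁ c
        a  = proj₂ c
      field
        W            : List (Fin K)
        remaining    : length W + (toℕ (pc zero) ∸ n) ≡ m
        contributors : ∀ k {u} → pc (suc k) ≡ suc u → CoveredBy W u
        names        : ∀ {j} → a ≡ name j → j ∈ W
        elems        : ∀ {u} → a ≡ elem u → CoveredBy W u
        reported     : ∀ u → toℕ (pc zero) ≤ toℕ u → CoveredBy W u

    inv-c⁰ : Inv c⁰
    inv-c⁰ = record
      { W            = []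
      ; remaining    = trans (cong (_∸ n) (Finₚ.toℕ-fromℕ (n + m))) (ℕₚ.m+n∸m≡n n m)
      ; contributors = λ _ ()
      ; names        = λ ()
      ; elems        = λ ()
      ; reported     = λ u le → ⊥-elim (ℕₚ.<⇒≱ (Finₚ.toℕ<n u)
          (ℕₚ.≤-trans (ℕₚ.m≤m+n n m) (subst (_≤ toℕ u) (Finₚ.toℕ-fromℕ (n + m)) le)))
      }

    inv-step : ∀ {c c′} → c ⟶ c′ → Inv c → Inv c′
    inv-step {pc , a} {pc′ , a′} (step zero tr eff same) inv with Equivalence.to (∈-leaderδ m) tr
    -- The equation of triples is taken apart because only the label can be unified away: `pc zero`
    -- is an application, not a variable.
    ... | inj₁ (i , j , eq) = leader-announce (cong proj₁ eq) (cong (proj₁ ∘ proj₂) eq) (cong (proj₂ ∘ proj₂) eq) eff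
      where
      open Inv inv
      leader-announce : ∀ {o} → pc zero ≡ suc (n ↑ʳ i) → o ≡ just (! name j) →
                 pc′ zero ≡ inject₁ (n ↑ʳ i) → Effect o a a′ → Inv (pc′ , a′)
      leader-announce q refl q′ write = record
        { W            = j ∷ W
        ; remaining    = begin
            suc (length W) + (toℕ (pc′ zero) ∸ n)  ≡⟨ cong (λ x → suc (length W) + (x ∸ n)) pc′≡ ⟩
            suc (length W) + ((n + toℕ i) ∸ n)     ≡⟨ cong (suc (length W) +_) (ℕₚ.m+n∸m≡n n (toℕ i)) ⟩
            suc (length W) + toℕ i                 ≡⟨ ℕₚ.+-suc (length W) (toℕ i) ⟨
            length W + suc (toℕ i)                 ≡⟨ cong (length W +_) (ℕₚ.m+n∸m≡n n (suc (toℕ i))) ⟨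
            length W + ((n + suc (toℕ i)) ∸ n)     ≡⟨ cong (λ x → length W + (x ∸ n)) pc≡ ⟨
            length W + (toℕ (pc zero) ∸ n)         ≡⟨ remaining ⟩
            m                                      ∎
        ; contributors = λ k e → coveredBy-∷ j (contributors k (trans (sym (same (suc k) λ ())) e))
        ; names        = λ e → Any.here (sym (name-injective e))
        ; elems        = λ e → ⊥-elim (elem≢name (sym e))
        -- While announcing, the leader stays at n or above, so no element counts as read yet.
        ; reported     = λ u le → ⊥-elim (ℕₚ.<⇒≱ (Finₚ.toℕ<n u)
            (ℕₚ.≤-trans (ℕₚ.m≤m+n n (toℕ i)) (subst (_≤ toℕ u) pc′≡ le)))
        }
        where
        open ≡-Reasoning
        pc≡ : toℕ (pc zero) ≡ n + suc (toℕ i)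
        pc≡ = trans (cong toℕ q) (trans (cong suc (Finₚ.toℕ-↑ʳ n i)) (sym (ℕₚ.+-suc n (toℕ i))))
        pc′≡ : toℕ (pc′ zero) ≡ n + toℕ i
        pc′≡ = trans (cong toℕ q′) (trans (Finₚ.toℕ-inject₁ _) (Finₚ.toℕ-↑ʳ n i))
    ... | inj₂ (inj₁ (u , eq)) = leader-await (cong proj₁ eq) (cong (proj₁ ∘ proj₂) eq) (cong (proj₂ ∘ proj₂) eq) eff
      where
      open Inv inv
      leader-await : ∀ {o} → pc zero ≡ suc (u ↑ˡ m) → o ≡ just (¿ elem u) →
              pc′ zero ≡ inject₁ (u ↑ˡ m) → Effect o a a′ → Inv (pc′ , a′)
      leader-await q refl q′ read = record
        { W            = W
        -- Both leader states are at most n, so both differences are truncated to 0.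
        ; remaining    = trans (cong (length W +_) (trans
            (ℕₚ.m≤n⇒m∸n≡0 (subst (_≤ n) (sym pc′≡) (ℕₚ.<⇒≤ (Finₚ.toℕ<n u))))
            (sym (ℕₚ.m≤n⇒m∸n≡0 (subst (_≤ n) (sym pc≡) (Finₚ.toℕ<n u)))))) remaining
        ; contributors = λ k e → contributors k (trans (sym (same (suc k) λ ())) e)
        ; names        = names
        ; elems        = elems
        -- The only new obligation is u itself, and the memory displayed it when the leader read it.
        ; reported     = λ v le → case ℕₚ.m≤n⇒m<n∨m≡n (subst (_≤ toℕ v) pc′≡ le) of λ
            { (inj₁ u<v) → reported v (subst (_≤ toℕ v) (sym pc≡) u<v)
            ; (inj₂ u≡v) → subst (CoveredBy W) (Finₚ.toℕ-injective u≡v) (elems refl)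
            }
        }
        where
        pc≡ : toℕ (pc zero) ≡ suc (toℕ u)
        pc≡ = trans (cong toℕ q) (cong suc (Finₚ.toℕ-↑ˡ u m))
        pc′≡ : toℕ (pc′ zero) ≡ toℕ u
        pc′≡ = trans (cong toℕ q′) (trans (Finₚ.toℕ-inject₁ _) (Finₚ.toℕ-↑ˡ u m))
    ... | inj₂ (inj₂ ())
    inv-step {pc , a} {pc′ , a′} (step (suc k) tr eff same) inv with Equivalence.to (∈-contributorδ S) tr
    ... | inj₁ (j , u , Sju , eq) = picks (cong (proj₁ ∘ proj₂) eq) (cong (proj₂ ∘ proj₂) eq) eff
      where
      open Inv inv
      picks : ∀ {o} → o ≡ just (¿ name j) → pc′ (suc k) ≡ suc u → Effect o a a′ → Inv (pc′ , a′)
      picks refl q′ read = record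
        { W            = W
        ; remaining    = trans (cong (λ x → length W + (toℕ x ∸ n)) (same zero λ ())) remaining
        ; contributors = λ l e → case l Finₚ.≟ k of λ
            { (yes refl) → j , names refl , subst (_∈ₛ S j) (Finₚ.suc-injective (trans (sym q′) e))
                             (Vecₚ.lookup⇒[]= u (S j) Sju)
            ; (no l≢k)   → contributors l (trans (sym (same (suc l) (l≢k ∘ Finₚ.suc-injective))) e)
            }
        ; names        = names
        ; elems        = elems
        ; reported     = λ v le → reported v (subst (λ x → toℕ x ≤ toℕ v) (same zero λ ()) le)
        }
    ... | inj₂ (inj₁ (u , eq)) = reports (cong proj₁ eq) (cong (proj₁ ∘ proj₂) eq) (cong (proj₂ ∘ proj₂) eq) eff
      where
      open Inv inv
      reports : ∀ {o} → pc (suc k) ≡ suc u → o ≡ just (! elem u) → pc′ (suc k) ≡ suc u →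
                Effect o a a′ → Inv (pc′ , a′)
      reports q refl q′ write = record
        { W            = W
        ; remaining    = trans (cong (λ x → length W + (toℕ x ∸ n)) (same zero λ ())) remaining
        ; contributors = λ l e → case l Finₚ.≟ k of λ
            { (yes refl) → contributors l (trans q (trans (sym q′) e))
            ; (no l≢k)   → contributors l (trans (sym (same (suc l) (l≢k ∘ Finₚ.suc-injective))) e)
            }
        ; names        = λ e → ⊥-elim (elem≢name e)
        ; elems        = λ e → subst (CoveredBy W) (elem-injective e) (contributors k q)
        ; reported     = λ v le → reported v (subst (λ x → toℕ x ≤ toℕ v) (same zero λ ()) le)
        }
    ... | inj₂ (inj₂ ())

    inv-steps : ∀ {c c′} → c ⟶* c′ → Inv c → Inv c′
    inv-steps done     inv = inv
    inv-steps (s ◅ ss) inv = inv-steps ss (inv-step s inv)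

  ∈F-L⇒zero : ∀ {x : Fin (suc (n + m))} → x ∈ₛ LCRInstance.F-L lcr → x ≡ zero
  ∈F-L⇒zero {zero}  _ = refl
  ∈F-L⇒zero {suc x} x∈ with trans (sym (Vecₚ.[]=⇒lookup x∈)) (Vecₚ.lookup-replicate x false)
  ... | ()

  -- In leader state 0 no announcement remains, so W has length m and can serve as the choice, and
  -- `reported` applies to every element.
  reaches⇒cover : ReachesC^f lcr → Cover S m
  reaches⇒cover (t , c , steps , final) =
    subst (Cover S) length≡m (cover (List.lookup W) λ u →
      let j , j∈W , u∈ = reported u (subst (λ x → toℕ x ≤ toℕ u) (sym pc≡zero) z≤n)
      in Any.index j∈W , subst (λ j → u ∈ₛ S j) (Anyₚ.lookup-index j∈W) u∈)
    where
    open Soundness t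
    open Inv (inv-steps steps inv-c⁰)
    pc≡zero : proj₁ c zero ≡ zero
    pc≡zero = ∈F-L⇒zero final
    length≡m : length W ≡ m
    length≡m = trans (sym (trans (cong (λ x → length W + (toℕ x ∸ n)) pc≡zero)
      (trans (cong (length W +_) (ℕₚ.0∸n≡0 n)) (ℕₚ.+-identityʳ _)))) remaining

  module Completeness (c : Cover S m) where
    open Cover c
    open Semantics (lcr ^^ n)

    -- The stage at which contributor u reads. It is whichever stage the cover supplies for u, not
    -- necessarily the earliest.
    first : Fin n → Fin m
    first = proj₁ ∘ covers

    -- Configurations contain functions, so the contributor states of a reachable one are prescribed
    -- only pointwise.
    record Reach (x : Fin (suc (n + m))) (f : Fin n → Fin (suc n)) (a : Value {n} {K}) : Set where
      field
        pc     : ∀ i → Fin (NFA.∣Q∣ (Program.P (lcr ^^ n) i))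
        steps  : c⁰ ⟶* (pc , a)
        pc₀≡x  : pc zero ≡ x
        pcₛ≗f  : ∀ u → pc (suc u) ≡ f u

    reach-cong : ∀ {x f g a} → f ≗ g → Reach x f a → Reach x g a
    reach-cong f≗g r = record
      { pc = pc ; steps = steps ; pc₀≡x = pc₀≡x ; pcₛ≗f = λ u → trans (pcₛ≗f u) (f≗g u) }
      where open Reach r

    reach-leader : ∀ {x y f a b o} → Reach x f a → (x , o , y) ∈ leaderδ m → Effect o a b → Reach y f b
    reach-leader {y = y} {f} r tr eff = record
      { pc    = pc′
      ; steps = steps ◅◅ step zero (subst (λ x → (x , _ , y) ∈ leaderδ m) (sym pc₀≡x) tr) eff same ◅ done
      ; pc₀≡x = refl
      ; pcₛ≗f = λ _ → refl
      }
      where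
      open Reach r
      pc′ : ∀ i → Fin (NFA.∣Q∣ (Program.P (lcr ^^ n) i))
      pc′ zero    = y
      pc′ (suc u) = f u
      same : ∀ i → i ≢ zero → pc′ i ≡ pc i
      same zero    i≢0 = ⊥-elim (i≢0 refl)
      same (suc u) _   = sym (pcₛ≗f u)

    reach-contributor : ∀ {x f g a b o} u → Reach x f a → (f u , o , g u) ∈ contributorδ S →
                        Effect o a b → (∀ v → v ≢ u → g v ≡ f v) → Reach x g b
    reach-contributor {x} {f} {g} u r tr eff g≡f = record
      { pc    = pc′
      ; steps = steps ◅◅
          step (suc u) (subst (λ q → (q , _ , g u) ∈ contributorδ S) (sym (pcₛ≗f u)) tr) eff same ◅ done
      ; pc₀≡x = refl
      ; pcₛ≗f = λ _ → refl
      }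
      where
      open Reach r
      pc′ : ∀ i → Fin (NFA.∣Q∣ (Program.P (lcr ^^ n) i))
      pc′ zero    = x
      pc′ (suc u) = g u
      same : ∀ i → i ≢ suc u → pc′ i ≡ pc i
      same zero    _   = sym pc₀≡x
      same (suc v) v≢u = trans (g≡f v (v≢u ∘ cong suc)) (sym (pcₛ≗f v))

    module _ {x : Fin (suc (n + m))} {a : Value {n} {K}} {f g : Fin n → Fin (suc n)}
             (f→g : ∀ u → g u ≡ f u ⊎ (f u , just (¿ a) , g u) ∈ contributorδ S) where

      -- Reads leave the memory at a, so the contributors can move one after another; in `mix k`
      -- those with index below k have moved.
      mix : ℕ → Fin n → Fin (suc n)
      mix k u with toℕ u ℕₚ.<? k
      ... | yes _ = g u
      ... | no  _ = f u

      mix-< : ∀ {k u} → toℕ u < k → mix k u ≡ g u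
      mix-< {k} {u} u<k with toℕ u ℕₚ.<? k
      ... | yes _  = refl
      ... | no u≮k = ⊥-elim (u≮k u<k)

      mix-≥ : ∀ {k u} → k ≤ toℕ u → mix k u ≡ f u
      mix-≥ {k} {u} k≤u with toℕ u ℕₚ.<? k
      ... | yes u<k = ⊥-elim (ℕₚ.<⇒≱ u<k k≤u)
      ... | no _    = refl

      mix-suc : ∀ k v → toℕ v ≢ k → mix (suc k) v ≡ mix k v
      mix-suc k v v≢k with ℕₚ.<-cmp (toℕ v) k
      ... | tri< v<k _ _ = trans (mix-< (ℕₚ.m<n⇒m<1+n v<k)) (sym (mix-< v<k))
      ... | tri≈ _ v≡k _ = ⊥-elim (v≢k v≡k)
      ... | tri> _ _ k<v = trans (mix-≥ k<v) (sym (mix-≥ (ℕₚ.<⇒≤ k<v)))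

      reach-mix : Reach x f a → ∀ k → k ≤ n → Reach x (mix k) a
      reach-mix r zero    _   = reach-cong (λ u → sym (mix-≥ z≤n)) r
      reach-mix r (suc k) k<n = advance (f→g u)
        where
        u : Fin n
        u = Fin.fromℕ< k<n
        u≡k : toℕ u ≡ k
        u≡k = Finₚ.toℕ-fromℕ< k<n
        before : mix k u ≡ f u
        before = mix-≥ (ℕₚ.≤-reflexive (sym u≡k))
        after : mix (suc k) u ≡ g u
        after = mix-< (s≤s (ℕₚ.≤-reflexive u≡k))
        others : ∀ v → v ≢ u → mix (suc k) v ≡ mix k v
        others v v≢u = mix-suc k v (λ v≡k → v≢u (Finₚ.toℕ-injective (trans v≡k (sym u≡k))))
        advance : g u ≡ f u ⊎ (f u , just (¿ a) , g u) ∈ contributorδ S → Reach x (mix (suc k)) a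
        advance (inj₁ eq) = reach-cong
          (λ v → case v Finₚ.≟ u of λ
            { (yes refl) → trans before (trans (sym eq) (sym after))
            ; (no v≢u)   → sym (others v v≢u)
            })
          (reach-mix r k (ℕₚ.<⇒≤ k<n))
        advance (inj₂ tr) = reach-contributor u (reach-mix r k (ℕₚ.<⇒≤ k<n))
          (subst₂ (λ p q → (p , _ , q) ∈ contributorδ S) (sym before) (sym after) tr) read others

      reach-reads : Reach x f a → Reach x g a
      reach-reads r = reach-cong (λ u → mix-< (Finₚ.toℕ<n u)) (reach-mix r n ℕₚ.≤-refl)

    -- Contributors whose set is announced at stage k or earlier hold their
    -- element; the stages are numbered downwards.
    holding : ℕ → Fin n → Fin (suc n)
    holding k u with k ℕₚ.≤? toℕ (first u)
    ... | yes _ = suc u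
    ... | no  _ = zero

    holding-≤ : ∀ {k u} → k ≤ toℕ (first u) → holding k u ≡ suc u
    holding-≤ {k} {u} k≤ with k ℕₚ.≤? toℕ (first u)
    ... | yes _ = refl
    ... | no k≰ = ⊥-elim (k≰ k≤)

    holding-> : ∀ {k u} → toℕ (first u) < k → holding k u ≡ zero
    holding-> {k} {u} >k with k ℕₚ.≤? toℕ (first u)
    ... | yes k≤ = ⊥-elim (ℕₚ.<⇒≱ >k k≤)
    ... | no _   = refl

    initially : Reach (Fin.fromℕ (n + m)) (λ _ → zero) zero
    initially = record
      { pc = λ i → NFA.q⁰ (Program.P (lcr ^^ n) i) ; steps = done ; pc₀≡x = refl ; pcₛ≗f = λ _ → refl }

    -- After j announcements k remain. As soon as the name of stage k is in memory, the contributors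
    -- assigned to that stage all read it, before the next announcement overwrites it.
    announcements : ∀ j k → j + k ≡ m →
                    ∃[ x ] ∃[ a ] toℕ x ≡ n + k × Reach x (holding k) a
    announcements zero    k refl = _ , _ , Finₚ.toℕ-fromℕ _ ,
      reach-cong (λ u → sym (holding-> (Finₚ.toℕ<n (first u)))) initially
    announcements (suc j) k eq with announcements j (suc k) (trans (ℕₚ.+-suc j k) eq)
    ... | x , _ , x≡ , r = _ , _ , x′≡ , reach-reads reads
        (reach-leader r (subst (λ x → (x , proj₂ (announce m i (choice i))) ∈ leaderδ m) (sym x≡suc)
          (Equivalence.from (∈-leaderδ m) (inj₁ (i , choice i , refl)))) write)
      where
      k<m : k < m
      k<m = subst (suc k ≤_) eq (s≤s (ℕₚ.m≤n+m k j))
      i : Fin m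
      i = Fin.fromℕ< k<m
      i≡k : toℕ i ≡ k
      i≡k = Finₚ.toℕ-fromℕ< k<m
      n↑i≡ : toℕ (n ↑ʳ i) ≡ n + k
      n↑i≡ = trans (Finₚ.toℕ-↑ʳ n i) (cong (n +_) i≡k)
      x≡suc : x ≡ suc (n ↑ʳ i)
      x≡suc = Finₚ.toℕ-injective (trans x≡ (trans (ℕₚ.+-suc n k) (cong suc (sym n↑i≡))))
      x′≡ : toℕ (inject₁ (n ↑ʳ i)) ≡ n + k
      x′≡ = trans (Finₚ.toℕ-inject₁ (n ↑ʳ i)) n↑i≡
      reads : ∀ u → holding k u ≡ holding (suc k) u ⊎
                    (holding (suc k) u , just (¿ name (choice i)) , holding k u) ∈ contributorδ S
      reads u with ℕₚ.<-cmp (toℕ (first u)) k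
      ... | tri< <k _ _ = inj₁ (trans (holding-> <k) (sym (holding-> (ℕₚ.m<n⇒m<1+n <k))))
      ... | tri> _ _ k< = inj₁ (trans (holding-≤ (ℕₚ.<⇒≤ k<)) (sym (holding-≤ k<)))
      ... | tri≈ _ ≡k _ = inj₂ (subst₂ (λ p q → (p , _ , q) ∈ contributorδ S)
        (sym (holding-> (s≤s (ℕₚ.≤-reflexive ≡k)))) (sym (holding-≤ (ℕₚ.≤-reflexive (sym ≡k))))
        (Equivalence.from (∈-contributorδ S) (inj₁ (choice i , u ,
          Vecₚ.[]=⇒lookup (subst (λ i → u ∈ₛ S (choice i)) first≡i (proj₂ (covers u))) , refl))))
        where
        first≡i : first u ≡ i
        first≡i = Finₚ.toℕ-injective (trans ≡k (sym i≡k))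

    -- Every contributor holds its own element by now, so contributor k writes right before the
    -- leader, in state k + 1, reads.
    reports : ∀ j k → j + k ≡ n → ∃[ x ] ∃[ a ] toℕ x ≡ k × Reach x suc a
    reports zero    k refl with announcements m 0 (ℕₚ.+-identityʳ m)
    ... | x , a , x≡ , r = x , a , trans x≡ (ℕₚ.+-identityʳ n) , reach-cong (λ u → holding-≤ z≤n) r
    reports (suc j) k eq with reports j (suc k) (trans (ℕₚ.+-suc j k) eq)
    ... | x , _ , x≡ , r = _ , _ , x′≡ , reach-leader
        (reach-contributor {g = suc} u r
          (Equivalence.from (∈-contributorδ S) (inj₂ (inj₁ (u , refl)))) write (λ _ _ → refl))
        (subst (λ x → (x , proj₂ (await m u)) ∈ leaderδ m) (sym x≡suc)
          (Equivalence.from (∈-leaderδ m) (inj₂ (inj₁ (u , refl))))) read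
      where
      k<n : k < n
      k<n = subst (suc k ≤_) eq (s≤s (ℕₚ.m≤n+m k j))
      u : Fin n
      u = Fin.fromℕ< k<n
      u↑≡ : toℕ (u ↑ˡ m) ≡ k
      u↑≡ = trans (Finₚ.toℕ-↑ˡ u m) (Finₚ.toℕ-fromℕ< k<n)
      x≡suc : x ≡ suc (u ↑ˡ m)
      x≡suc = Finₚ.toℕ-injective (trans x≡ (cong suc (sym u↑≡)))
      x′≡ : toℕ (inject₁ (u ↑ˡ m)) ≡ k
      x′≡ = trans (Finₚ.toℕ-inject₁ (u ↑ˡ m)) u↑≡

    reaches : ReachesC^f lcr
    reaches with reports n 0 (ℕₚ.+-identityʳ n)
    ... | x , a , x≡0 , r = n , (pc , a) , steps , subst (_∈ₛ LCRInstance.F-L lcr)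
      (sym (trans pc₀≡x (Finₚ.toℕ-injective x≡0))) here
      where open Reach r

  reaches⇔cover : ReachesC^f lcr ⇔ Cover S m
  reaches⇔cover = mk⇔ reaches⇒cover Completeness.reaches

-- The program computing the LCR instance

run-≡ : ∀ {c ρ ρ′ ρ″ b} → ρ′ ≡ ρ″ → Run c ρ ρ′ b → Run c ρ ρ″ b
run-≡ refl r = r

encodeℕ≡encodeList : ∀ n → encodeList (λ _ → nil) (toList (Vec.replicate n tt)) ≡ encodeℕ n
encodeℕ≡encodeList zero    = refl
encodeℕ≡encodeList (suc n) = cong (nil ∙_) (encodeℕ≡encodeList n)

run-loopℕ : ∀ {S : Set} {x body b} m (R : Tree → ℕ → S → Regs) (g : Fin m → S → S) →
            (∀ c k s → store (R c k s) x ≡ c) →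
            (∀ i c s → Run body (R (nil ∙ c) (toℕ i) s) (R c (suc (toℕ i)) (g i s)) b) →
            ∀ s → Run (while var x loop body) (R (encodeℕ m) 0 s) (R nil m (applyAll g s)) (loopTime m b)
run-loopℕ {x = x} {body} {b} m R g test step s =
  subst (λ c → Run (while var x loop body) (R c 0 s) (R nil m (applyAll g s)) (loopTime m b))
    (encodeℕ≡encodeList m) (run-loop (Vec.replicate m tt) R g test step s)

lookup-fromList : ∀ {A : Set} (xs : List A) i → Vec.lookup (Vec.fromList xs) i ≡ List.lookup xs i
lookup-fromList (x ∷ xs) zero    = refl
lookup-fromList (x ∷ xs) (suc i) = lookup-fromList xs i

run-loopList : ∀ {A S : Set} {x body b} {f : A → Tree} (xs : List A)
               (R : Tree → ℕ → S → Regs) (g : Fin (length xs) → S → S) →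
               (∀ c k s → store (R c k s) x ≡ c) →
               (∀ i c s → Run body (R (f (List.lookup xs i) ∙ c) (toℕ i) s) (R c (suc (toℕ i)) (g i s)) b) →
               ∀ s → Run (while var x loop body) (R (encodeList f xs) 0 s)
                         (R nil (length xs) (applyAll g s)) (loopTime (length xs) b)
run-loopList {x = x} {body} {b} {f} xs R g test step s =
  subst (λ ys → Run (while var x loop body) (R (encodeList f ys) 0 s)
                    (R nil (length xs) (applyAll g s)) (loopTime (length xs) b))
    (Vecₚ.toList∘fromList xs)
    (run-loop (Vec.fromList xs) R g test
      (λ i c s → subst (λ y → Run body (R (f y ∙ c) (toℕ i) s) (R c (suc (toℕ i)) (g i s)) b)
        (sym (lookup-fromList xs i)) (step i c s)) s)

-- A copy of the function local to `encodeNFA`. The two agree definitionally, which lets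
-- `encode-reduce` end in `refl`.
encodeTransition : ∀ {d q} → Fin q × Label d × Fin q → Tree
encodeTransition (q , o , q′) = encodeFin q ∙ encodeLabel o ∙ encodeFin q′

-- Registers: 0 input and output, 1 n, 2 ℱ, 3 r and later the current element,
-- 4 the number of sets, 5 the number of stages, 6 the capped weight of the
-- current digit and later the current leader state, 7 the innermost loop,
-- 8 the room left below the cap and later the outer loop, 9 and 10 the
-- transitions of leader and contributor, 11 the name of the current set.
pattern reg a b c d e f g h i j k l =
  a ∷ b ∷ c ∷ d ∷ e ∷ f ∷ g ∷ h ∷ i ∷ j ∷ k ∷ l ∷ []

countBody count : Cmd
countBody = 4 := cons nil (var 4) ⨾ 7 := tl (var 7)
count = 7 := var 2 ⨾ while var 7 loop countBody

run-count : ∀ {A : Set} {f : A → Tree} xs {i n r} →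
  Run count (reg i n (encodeList f xs) r nil nil nil nil nil nil nil nil)
            (reg i n (encodeList f xs) r (encodeℕ (length xs)) nil nil nil nil nil nil nil)
            (2 + loopTime (length xs) (straight countBody))
run-count {f = f} xs {i} {n} {r} = run-assign ▸
  run-loopList xs R (λ _ → id) (λ _ _ _ → refl) (λ _ _ _ → run-assign ▸ run-assign) tt
  where
  R : Tree → ℕ → ⊤ → Regs
  R c k _ = reg i n (encodeList f xs) r (encodeℕ k) nil nil c nil nil nil nil

awaitTree reportTree : Tree → Tree
awaitTree u  = (nil ∙ u) ∙ ((nil ∙ nil) ∙ (nil ∙ u)) ∙ u
reportTree u = (nil ∙ u) ∙ (nil ∙ (nil ∙ u)) ∙ (nil ∙ u)

announceTree pickTree : Tree → Tree → Tree
announceTree s v = (nil ∙ s) ∙ (nil ∙ v) ∙ s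
pickTree v u     = nil ∙ ((nil ∙ nil) ∙ v) ∙ (nil ∙ u)

module _ {n K : ℕ} where

  encode-await : ∀ m u → encodeTransition (await {n} {K} m u) ≡ awaitTree (encodeFin u)
  encode-await m u rewrite Finₚ.toℕ-inject₁ (u ↑ˡ m) | Finₚ.toℕ-↑ˡ u m | Finₚ.toℕ-↑ˡ u K = refl

  encode-report : ∀ (S : Fin K → Subset n) u → encodeTransition (report S u) ≡ reportTree (encodeFin u)
  encode-report S u rewrite Finₚ.toℕ-↑ˡ u K = refl

  encode-announce : ∀ m i j → encodeTransition (announce {n} {K} m i j) ≡
    announceTree (encodeℕ (toℕ i + n)) (nil ∙ encodeℕ (toℕ j + n))
  encode-announce m i j rewrite Finₚ.toℕ-inject₁ (n ↑ʳ i) | Finₚ.toℕ-↑ʳ n i | Finₚ.toℕ-↑ʳ n j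
    | ℕₚ.+-comm n (toℕ i) | ℕₚ.+-comm n (toℕ j) = refl

  encode-pick : ∀ (S : Fin K → Subset n) j u → encodeTransition (pick S j u) ≡
    pickTree (nil ∙ encodeℕ (toℕ j + n)) (encodeFin u)
  encode-pick S j u rewrite Finₚ.toℕ-↑ʳ n j | ℕₚ.+-comm n (toℕ j) = refl

awaitsBody reportsBody awaits reports : Cmd
awaitsBody =
  9 := cons (cons (cons nil (var 6)) (cons (cons (cons nil nil) (cons nil (var 6))) (var 6))) (var 9)
  ⨾ 6 := cons nil (var 6) ⨾ 7 := tl (var 7)
awaits = 7 := var 1 ⨾ 6 := nil ⨾ while var 7 loop awaitsBody
reportsBody =
  10 := cons (cons (cons nil (var 6)) (cons (cons nil (cons nil (var 6))) (cons nil (var 6)))) (var 10)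
  ⨾ 6 := cons nil (var 6) ⨾ 7 := tl (var 7)
reports = 7 := var 1 ⨾ 6 := nil ⨾ while var 7 loop reportsBody

run-awaits : ∀ {n K m i f r k q p g δ v} (acc : List (LTrans {n} {K} m)) →
  Run awaits (reg i (encodeℕ n) f r k q p nil g (encodeList encodeTransition acc) δ v)
             (reg i (encodeℕ n) f r k q (encodeℕ n) nil g
               (encodeList encodeTransition (applyAll (λ u → await m u ∷_) acc)) δ v)
             (4 + loopTime n (straight awaitsBody))
run-awaits {n} {K} {m} {i} {f} {r} {k} {q} {_} {g} {δ} {v} acc = run-assign ▸ run-assign ▸
  run-loopℕ n R (λ u → await m u ∷_) (λ _ _ _ → refl)
    (λ u c acc → run-≡
      (cong (λ t → reg i (encodeℕ n) f r k q (encodeℕ (suc (toℕ u))) c g (t ∙ encodeList encodeTransition acc) δ v)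
        (sym (encode-await {n} {K} m u)))
      (run-assign ▸ run-assign ▸ run-assign)) acc
  where
  R : Tree → ℕ → List (LTrans m) → Regs
  R c u acc = reg i (encodeℕ n) f r k q (encodeℕ u) c g (encodeList encodeTransition acc) δ v

run-reports : ∀ {n K i f r k q p g δ v} (S : Fin K → Subset n) (acc : List (CTrans S)) →
  Run reports (reg i (encodeℕ n) f r k q p nil g δ (encodeList encodeTransition acc) v)
              (reg i (encodeℕ n) f r k q (encodeℕ n) nil g δ
                (encodeList encodeTransition (applyAll (λ u → report S u ∷_) acc)) v)
              (4 + loopTime n (straight reportsBody))
run-reports {n} {K} {i} {f} {r} {k} {q} {_} {g} {δ} {v} S acc = run-assign ▸ run-assign ▸
  run-loopℕ n R (λ u → report S u ∷_) (λ _ _ _ → refl)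
    (λ u c acc → run-≡
      (cong (λ t → reg i (encodeℕ n) f r k q (encodeℕ (suc (toℕ u))) c g δ (t ∙ encodeList encodeTransition acc) v)
        (sym (encode-report S u)))
      (run-assign ▸ run-assign ▸ run-assign)) acc
  where
  R : Tree → ℕ → List (CTrans S) → Regs
  R c u acc = reg i (encodeℕ n) f r k q (encodeℕ u) c g δ (encodeList encodeTransition acc) v

-- Register 6 still holds n from `reports` and rises by one per stage, up to n + m. Register 11
-- restarts in every stage at n + 1, the name of set 0.
announceBody stageBody announces : Cmd
announceBody =
  9 := cons (cons (cons nil (var 6)) (cons (cons nil (var 11)) (var 6))) (var 9)
  ⨾ 11 := cons nil (var 11) ⨾ 7 := tl (var 7)
stageBody = 7 := var 4 ⨾ 11 := cons nil (var 1) ⨾ while var 7 loop announceBody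
  ⨾ 11 := nil ⨾ 6 := cons nil (var 6) ⨾ 8 := tl (var 8)
announces = 8 := var 5 ⨾ while var 8 loop stageBody

stageTime : ℕ → ℕ
stageTime K = 2 + (4 + (loopTime K (straight announceBody) + (2 + (4 + 3))))

run-announces : ∀ {n K m i f r g δ} (acc : List (LTrans {n} {K} m)) →
  Run announces
    (reg i (encodeℕ n) f r (encodeℕ K) (encodeℕ m) (encodeℕ n) nil g (encodeList encodeTransition acc) δ nil)
    (reg i (encodeℕ n) f r (encodeℕ K) (encodeℕ m) (encodeℕ (m + n)) nil nil
      (encodeList encodeTransition (applyAll (λ i → applyAll (λ j → announce m i j ∷_)) acc)) δ nil)
    (2 + loopTime m (stageTime K))
run-announces {n} {K} {m} {i} {f} {r} {g} {δ} acc = run-assign ▸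
  run-loopℕ m R (λ s → applyAll (λ j → announce m s j ∷_)) (λ _ _ _ → refl)
    (λ s c acc → run-assign ▸ run-assign ▸
      run-loopℕ K (R′ (nil ∙ c) (toℕ s)) (λ j → announce m s j ∷_) (λ _ _ _ → refl)
        (λ j c′ acc → run-≡
          (cong (λ t → reg i (encodeℕ n) f r (encodeℕ K) (encodeℕ m) (encodeℕ (toℕ s + n)) c′ (nil ∙ c)
                         (t ∙ encodeList encodeTransition acc) δ (nil ∙ encodeℕ (suc (toℕ j) + n)))
            (sym (encode-announce m s j)))
          (run-assign ▸ run-assign ▸ run-assign)) acc
      ▸ run-assign ▸ run-assign ▸ run-assign) acc
  where
  R : Tree → ℕ → List (LTrans m) → Regs
  R c s acc = reg i (encodeℕ n) f r (encodeℕ K) (encodeℕ m) (encodeℕ (s + n)) nil c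
    (encodeList encodeTransition acc) δ nil
  R′ : Tree → ℕ → Tree → ℕ → List (LTrans m) → Regs
  R′ c s c′ j acc = reg i (encodeℕ n) f r (encodeℕ K) (encodeℕ m) (encodeℕ (s + n)) c′ c
    (encodeList encodeTransition acc) δ (nil ∙ encodeℕ (j + n))

-- For a non-member register 10 is assigned to itself, as WHILE has no skip. Register 3 is nil after
-- `capping` and can count elements.
pickBody setBody picks : Cmd
pickBody =
  if hd (var 7) then 10 := cons (cons nil (cons (cons (cons nil nil) (var 11)) (cons nil (var 3)))) (var 10)
                else (10 := var 10)
  ⨾ 3 := cons nil (var 3) ⨾ 7 := tl (var 7)
setBody = 7 := hd (var 2) ⨾ while var 7 loop pickBody
  ⨾ 3 := nil ⨾ 11 := cons nil (var 11) ⨾ 2 := tl (var 2)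
picks = 11 := cons nil (var 1) ⨾ while var 2 loop setBody

setTime : ℕ → ℕ
setTime n = 3 + (loopTime n (straight pickBody) + (2 + (4 + 3)))

run-picks : ∀ {n i k q p g δ} (ℱ : List (Subset n)) (acc : List (CTrans (List.lookup ℱ))) →
  Run picks
    (reg i (encodeℕ n) (encodeList encodeSubset ℱ) nil k q p nil g δ (encodeList encodeTransition acc) nil)
    (reg i (encodeℕ n) nil nil k q p nil g δ (encodeList encodeTransition
        (applyAll (λ j → applyAll λ u →
          ifᵇ Vec.lookup (List.lookup ℱ j) u then pick (List.lookup ℱ) j u ∷_ else id) acc))
      (nil ∙ encodeℕ (length ℱ + n)))
    (4 + loopTime (length ℱ) (setTime n))
run-picks {n} {i} {k} {q} {p} {g} {δ} ℱ acc = run-assign ▸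
  run-loopList ℱ R (λ j → applyAll (insert j)) (λ _ _ _ → refl)
    (λ j c acc → run-assign ▸
      run-loop (S j) (R′ (encodeSubset (S j) ∙ c) (toℕ j)) (insert j) (λ _ _ _ → refl) (run-pick _ j) acc
      ▸ run-assign ▸ run-assign ▸ run-assign) acc
  where
  S : Fin (length ℱ) → Subset n
  S = List.lookup ℱ
  insert : Fin (length ℱ) → Fin n → List (CTrans S) → List (CTrans S)
  insert j u = ifᵇ Vec.lookup (S j) u then pick S j u ∷_ else id
  R : Tree → ℕ → List (CTrans S) → Regs
  R c j acc = reg i (encodeℕ n) c nil k q p nil g δ (encodeList encodeTransition acc) (nil ∙ encodeℕ (j + n))
  R′ : Tree → ℕ → Tree → ℕ → List (CTrans S) → Regs
  R′ c j c′ u acc = reg i (encodeℕ n) c (encodeℕ u) k q p c′ g δ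
    (encodeList encodeTransition acc) (nil ∙ encodeℕ (j + n))
  run-pick : ∀ c j u c′ acc → Run pickBody
    (R′ c (toℕ j) (encodeBool (Vec.lookup (S j) u) ∙ c′) (toℕ u) acc)
    (R′ c (toℕ j) c′ (suc (toℕ u)) (insert j u acc)) (straight pickBody)
  run-pick c j u c′ acc with Vec.lookup (S j) u
  ... | true  = run-≡
    (cong (λ t → reg i (encodeℕ n) c (encodeℕ (suc (toℕ u))) k q p c′ g δ
                   (t ∙ encodeList encodeTransition acc) (nil ∙ encodeℕ (toℕ j + n)))
      (sym (encode-pick S j u)))
    (run-then cons≢nil run-assign ▸ run-assign ▸ run-assign)
  ... | false = run-else refl run-assign ▸ run-assign ▸ run-assign

-- One loop over the units of the weight both multiplies and doubles: each unit adds the digit to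
-- register 5 and moves a unit, if one is left, from the room in 8 to the weight in 6. It runs over
-- a copy in 7 because 6 grows meanwhile.
unit digit capping : Cmd
unit =
  if hd (var 3) then (5 := cons nil (var 5)) else (5 := cons nil (cons nil (var 5)))
  ⨾ if var 8 then (6 := cons nil (var 6) ⨾ 8 := tl (var 8)) else (8 := nil)
  ⨾ 7 := tl (var 7)
digit = 7 := var 6 ⨾ while var 7 loop unit ⨾ 3 := tl (var 3)
capping = 6 := cons nil nil ⨾ 8 := var 4 ⨾ while var 3 loop digit

-- In `encodeBin` it is the digit 1 whose head is non-nil.
digitValue : Bool → ℕ
digitValue true  = 1
digitValue false = 2

unitStep : ℕ → ℕ × ℕ × ℕ → ℕ × ℕ × ℕ
unitStep d (s , p , g) = d + s , 1 ⊓ g + p , g ∸ 1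

-- For m = p the result lists the arguments of the recursive call in `capSum`.
applyAll-unitStep : ∀ d m s p g →
  applyAll {m = m} (λ _ → unitStep d) (s , p , g) ≡ (m * d + s , p + m ⊓ g , g ∸ m)
applyAll-unitStep d zero    s p g       = cong (λ p → s , p , g) (sym (ℕₚ.+-identityʳ p))
applyAll-unitStep d (suc m) s p zero    = trans (applyAll-unitStep d m (d + s) p 0)
  (cong₂ _,_ (trans (sym (ℕₚ.+-assoc (m * d) d s)) (cong (_+ s) (ℕₚ.+-comm (m * d) d)))
    (cong₂ _,_ (cong (p +_) (ℕₚ.⊓-zeroʳ m)) (ℕₚ.0∸n≡0 m)))
applyAll-unitStep d (suc m) s p (suc g) = trans (applyAll-unitStep d m (d + s) (suc p) g)
  (cong₂ _,_ (trans (sym (ℕₚ.+-assoc (m * d) d s)) (cong (_+ s) (ℕₚ.+-comm (m * d) d)))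
    (cong (_, g ∸ m) (sym (ℕₚ.+-suc p (m ⊓ g)))))

digitTime : ℕ → ℕ
digitTime p = 2 + (loopTime p (straight unit) + 3)

digitTime-mono : ∀ {p q} → p ≤ q → digitTime p ≤ digitTime q
digitTime-mono p≤q = ℕₚ.+-monoʳ-≤ 2 (ℕₚ.+-monoˡ-≤ 3 (ℕₚ.+-monoʳ-≤ 2 (ℕₚ.*-monoˡ-≤ (2 + straight unit) p≤q)))

module _ (i n f k : Tree) where

  capRegs : Tree → Tree → ℕ × ℕ × ℕ → Regs
  capRegs r c (s , p , g) = reg i n f r k (encodeℕ s) (encodeℕ p) c (encodeℕ g) nil nil nil

  run-unit : ∀ b r c st → Run unit (capRegs (encodeBool b ∙ r) (nil ∙ c) st)
                                   (capRegs (encodeBool b ∙ r) c (unitStep (digitValue b) st)) (straight unit)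
  run-unit true  r c (s , p , zero)  = run-then cons≢nil run-assign ▸ run-else refl run-assign ▸ run-assign
  run-unit true  r c (s , p , suc g) =
    run-then cons≢nil run-assign ▸ run-then cons≢nil (run-assign ▸ run-assign) ▸ run-assign
  run-unit false r c (s , p , zero)  = run-else refl run-assign ▸ run-else refl run-assign ▸ run-assign
  run-unit false r c (s , p , suc g) =
    run-else refl run-assign ▸ run-then cons≢nil (run-assign ▸ run-assign) ▸ run-assign

  run-digit : ∀ b r s p g → Run digit (capRegs (encodeBool b ∙ r) nil (s , p , g))
    (capRegs r nil (p * digitValue b + s , p + p ⊓ g , g ∸ p)) (digitTime p)
  run-digit b r s p g = run-assign ▸
    run-≡ (cong (capRegs (encodeBool b ∙ r) nil) (applyAll-unitStep (digitValue b) p s p g))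
      (run-loopℕ p (λ c _ → capRegs (encodeBool b ∙ r) c) (λ _ → unitStep (digitValue b)) (λ _ _ _ → refl)
        (λ _ c st → run-unit b r c st) (s , p , g))
    ▸ run-assign

  -- A digit takes time depending on its weight p, which is at most `p + g`. As that sum is
  -- invariant, one bound serves all digits.
  run-digits-step : ∀ {ρ} b r s p g t →
    Run (while var 3 loop digit) (capRegs r nil (p * digitValue b + s , p + p ⊓ g , g ∸ p)) ρ
        (loopTime t (digitTime ((p + p ⊓ g) + (g ∸ p)))) →
    Run (while var 3 loop digit) (capRegs (encodeBool b ∙ r) nil (s , p , g)) ρ (loopTime (suc t) (digitTime (p + g)))
  run-digits-step b r s p g t run =
    run-weaken (ℕₚ.≤-reflexive (loopTime-suc t (digitTime (p + g))))
      (run-step cons≢nil (run-weaken (digitTime-mono (ℕₚ.m≤m+n p g)) (run-digit b r s p g))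
        (run-weaken (ℕₚ.≤-reflexive (cong (loopTime t ∘ digitTime) (cap-invariant p g))) run))

  -- The final weight and room may stay unknown, because registers 6 and 8 are overwritten before
  -- they are next read.
  run-digits : ∀ b s p g → ∃[ p′ ] ∃[ g′ ] Run (while var 3 loop digit)
    (capRegs (encodeBin b) nil (s , p , g)) (capRegs nil nil (capSum b p g s , p′ , g′))
    (loopTime (ℕᵇ.size b) (digitTime (p + g)))
  run-digits ℕᵇ.zero  s p g = _ , _ , run-stop refl
  run-digits 2[1+ b ] s p g = let _ , _ , run = run-digits b _ _ _ in
    _ , _ , run-digits-step false (encodeBin b) s p g (ℕᵇ.size b) run
  run-digits 1+[2 b ] s p g = let _ , _ , run = run-digits b _ _ _ in
    _ , _ , run-digits-step true (encodeBin b) s p g (ℕᵇ.size b) run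

-- By the time of `output` register 6 has counted up to n + m, the initial leader state, and
-- register 11 to 1 + n + K, the size of the data domain. Register 6 also encodes the tail of the
-- final set, since n + m copies of `false` look like the unary number. `clear` is needed because
-- the LCR program expects nil in all other variables.
unpack output clear transform : Cmd
unpack = 1 := hd (var 0) ⨾ 2 := hd (tl (var 0)) ⨾ 3 := tl (tl (var 0))
output = 0 := cons (var 11) (cons nil
  (cons (cons (cons nil (var 6)) (cons (var 6) (var 9)))
  (cons (cons (cons nil (var 1)) (cons nil (var 10)))
  (cons (cons nil nil) (var 6)))))
clear = 1 := nil ⨾ 2 := nil ⨾ 3 := nil ⨾ 4 := nil ⨾ 5 := nil ⨾ 6 := nil
  ⨾ 7 := nil ⨾ 8 := nil ⨾ 9 := nil ⨾ 10 := nil ⨾ 11 := nil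
transform = unpack ⨾ count ⨾ capping ⨾ awaits ⨾ reports ⨾ announces ⨾ picks ⨾ output ⨾ clear

inputRegs : Tree → Regs
inputRegs t = reg t nil nil nil nil nil nil nil nil nil nil nil

module _ (I : SetCoverInstance) where
  open SetCoverInstance I

  stages : ℕ
  stages = cap r (length ℱ)

  reduce : LCRInstance
  reduce = coverLCR (List.lookup ℱ) stages

  transformTime : ℕ
  transformTime =
    straight unpack + (2 + loopTime K (straight countBody)
    + (6 + loopTime (ℕᵇ.size (ℕᵇ.fromℕ r)) (digitTime (suc K))
    + (4 + loopTime n (straight awaitsBody)
    + (4 + loopTime n (straight reportsBody)
    + (2 + loopTime stages (stageTime K)
    + (4 + loopTime K (setTime n)
    + (straight output + straight clear)))))))
    where
    K : ℕ
    K = length ℱ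

  leaderTree contributorTree : Tree
  leaderTree = encodeList encodeTransition (leaderδ {n} {length ℱ} stages)
  contributorTree = encodeList encodeTransition (contributorδ (List.lookup ℱ))

  encodeℕ≡encodeSubset : ∀ k → encodeSubset (Vec.replicate k false) ≡ encodeℕ k
  encodeℕ≡encodeSubset zero    = refl
  encodeℕ≡encodeSubset (suc k) = cong (nil ∙_) (encodeℕ≡encodeSubset k)

  encode-reduce : let s = encodeℕ (stages + n) in encodeLCR reduce ≡
    (nil ∙ encodeℕ (length ℱ + n)) ∙ nil
      ∙ ((nil ∙ s) ∙ s ∙ leaderTree) ∙ ((nil ∙ encodeℕ n) ∙ nil ∙ contributorTree) ∙ (nil ∙ nil) ∙ s
  encode-reduce
    rewrite ℕₚ.+-comm stages n | ℕₚ.+-comm (length ℱ) n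
          | Finₚ.toℕ-fromℕ (n + stages) | encodeℕ≡encodeSubset (n + stages) = refl

  run-transform : Run transform (inputRegs (encodeSetCover I)) (inputRegs (encodeLCR reduce)) transformTime
  run-transform = let _ , _ , run-capSum = run-digits i (encodeℕ n) f (encodeℕ K) (ℕᵇ.fromℕ r) 0 1 K in
    (run-assign ▸ run-assign ▸ run-assign)
    ▸ run-count ℱ
    ▸ (run-assign ▸ run-assign ▸ run-capSum)
    ▸ run-awaits []
    ▸ run-reports S []
    ▸ run-announces (applyAll (λ u → await stages u ∷_) [])
    ▸ run-picks ℱ (applyAll (λ u → report S u ∷_) [])
    ▸ run-≡ (cong (λ t → reg t (encodeℕ n) nil nil (encodeℕ K) (encodeℕ stages) (encodeℕ (stages + n)) nil nil
               leaderTree contributorTree (nil ∙ encodeℕ (K + n))) (sym encode-reduce))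
        run-assign
    ▸ run-assign ▸ run-assign ▸ run-assign ▸ run-assign ▸ run-assign ▸ run-assign ▸ run-assign
    ▸ run-assign ▸ run-assign ▸ run-assign ▸ run-assign
    where
    S : Fin (length ℱ) → Subset n
    S = List.lookup ℱ
    K : ℕ
    K = length ℱ
    i f : Tree
    i = encodeSetCover I
    f = encodeList encodeSubset ℱ

-- Polynomial bounds

Grows : ∀ {X : Set} → ℕ → (List X → List X) → Set
Grows b h = ∀ acc → length (h acc) ≤ b + length acc

grows-if : ∀ {X : Set} {h : List X → List X} c {b} → Grows b h → Grows b (ifᵇ c then h else id)
grows-if true      grows acc = grows acc
grows-if false {b} grows acc = ℕₚ.m≤n+m (length acc) b

grows-applyAll : ∀ {X : Set} {m b} {g : Fin m → List X → List X} → (∀ i → Grows b (g i)) → Grows (m * b) (applyAll g)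
grows-applyAll {m = zero}          grows acc = ℕₚ.≤-refl
grows-applyAll {m = suc m} {b} {g} grows acc = begin
  length (applyAll (g ∘ suc) (g zero acc))  ≤⟨ grows-applyAll {m = m} (grows ∘ suc) (g zero acc) ⟩
  m * b + length (g zero acc)               ≤⟨ ℕₚ.+-monoʳ-≤ (m * b) (grows zero acc) ⟩
  m * b + (b + length acc)                  ≡⟨ rearrange (m * b) b (length acc) ⟩
  suc m * b + length acc                    ∎
  where
  open ℕₚ.≤-Reasoning
  rearrange : ∀ x y z → x + (y + z) ≡ y + x + z
  rearrange = solve-∀

length-leaderδ : ∀ {n K} m → length (leaderδ {n} {K} m) ≤ m * (K * 1) + (n * 1 + 0)
length-leaderδ {n} {K} m = ℕₚ.≤-trans
  (grows-applyAll (λ i → grows-applyAll {g = λ j → announce m i j ∷_} λ _ _ → ℕₚ.≤-refl) awaits′)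
  (ℕₚ.+-monoʳ-≤ (m * (K * 1)) (grows-applyAll {g = λ u → await {n} {K} m u ∷_} (λ _ _ → ℕₚ.≤-refl) []))
  where
  awaits′ : List (LTrans m)
  awaits′ = applyAll (λ u → await {n} {K} m u ∷_) []

length-contributorδ : ∀ {n K} (S : Fin K → Subset n) → length (contributorδ S) ≤ K * (n * 1) + (n * 1 + 0)
length-contributorδ {n} {K} S = ℕₚ.≤-trans
  (grows-applyAll (λ j → grows-applyAll λ u → grows-if (Vec.lookup (S j) u) (adds j u)) reports′)
  (ℕₚ.+-monoʳ-≤ (K * (n * 1)) (grows-applyAll {g = λ u → report S u ∷_} (λ _ _ → ℕₚ.≤-refl) []))
  where
  reports′ : List (CTrans S)
  reports′ = applyAll (λ u → report S u ∷_) []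
  adds : ∀ j u → Grows 1 (pick S j u ∷_)
  adds j u acc = ℕₚ.≤-refl

-- Sizes of the encoded instances

size-encodeℕ : ∀ n → size (encodeℕ n) ≡ suc (2 * n)
size-encodeℕ zero    = refl
size-encodeℕ (suc n) = cong (2 +_) (trans (size-encodeℕ n) (sym (ℕₚ.+-suc n (n + 0))))

-- Wrapped in a record so that the tree remains visible to unification, where `size t` would compute
-- away.
record SizeBound (t : Tree) (b : ℕ) : Set where
  constructor ≤-size
  field
    size≤ : size t ≤ b
open SizeBound

sizeBound-∙ : ∀ {s t a b} → SizeBound s a → SizeBound t b → SizeBound (s ∙ t) (1 + (a + b))
sizeBound-∙ (≤-size s≤a) (≤-size t≤b) = ≤-size (s≤s (ℕₚ.+-mono-≤ s≤a t≤b))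

sizeBound-encodeℕ : ∀ n → SizeBound (encodeℕ n) (suc (2 * n))
sizeBound-encodeℕ n = ≤-size (ℕₚ.≤-reflexive (size-encodeℕ n))

sizeBound-encodeFin : ∀ {q} (i : Fin q) → SizeBound (encodeFin i) (suc (2 * q))
sizeBound-encodeFin {q} i = ≤-size (subst (_≤ suc (2 * q)) (sym (size-encodeℕ (toℕ i)))
  (s≤s (ℕₚ.*-monoʳ-≤ 2 (ℕₚ.<⇒≤ (Finₚ.toℕ<n i)))))

sizeBound-encodeList : ∀ {A : Set} {f : A → Tree} {b} → (∀ x → SizeBound (f x) b) →
                       ∀ xs {l} → length xs ≤ l → SizeBound (encodeList f xs) (suc (l * suc b))
sizeBound-encodeList         f≤b []       _                = ≤-size (s≤s z≤n)
sizeBound-encodeList {b = b} f≤b (x ∷ xs) {suc l} (s≤s le) = ≤-size (s≤s (ℕₚ.≤-trans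
  (ℕₚ.+-mono-≤ (size≤ (f≤b x)) (size≤ (sizeBound-encodeList f≤b xs le)))
  (ℕₚ.≤-reflexive (ℕₚ.+-suc b (l * suc b)))))

sizeBound-encodeLabel : ∀ {d} (o : Label d) → SizeBound (encodeLabel o) (4 + suc (2 * d))
sizeBound-encodeLabel nothing      = ≤-size (s≤s z≤n)
sizeBound-encodeLabel (just (! a)) =
  ≤-size (ℕₚ.≤-trans (ℕₚ.+-monoʳ-≤ 2 (size≤ (sizeBound-encodeFin a))) (ℕₚ.m≤n+m _ 2))
sizeBound-encodeLabel (just (¿ a)) = ≤-size (ℕₚ.+-monoʳ-≤ 4 (size≤ (sizeBound-encodeFin a)))

transitionBound : ℕ → ℕ → ℕ
transitionBound d q = 1 + (suc (2 * q) + (1 + ((4 + suc (2 * d)) + suc (2 * q))))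

nfaBound : ℕ → ℕ → ℕ → ℕ
nfaBound d q l = 1 + (suc (2 * q) + (1 + (suc (2 * q) + suc (l * suc (transitionBound d q)))))

sizeBound-encodeTransition : ∀ {d q} (x : Fin q × Label d × Fin q) →
                             SizeBound (encodeTransition x) (transitionBound d q)
sizeBound-encodeTransition (q , o , q′) =
  sizeBound-∙ (sizeBound-encodeFin q) (sizeBound-∙ (sizeBound-encodeLabel o) (sizeBound-encodeFin q′))

sizeBound-encodeNFA : ∀ {d} (A : NFA d) {l} → let open NFA A in
                      length δ ≤ l → SizeBound (encodeNFA A) (nfaBound d ∣Q∣ l)
sizeBound-encodeNFA A δ≤l = sizeBound-∙ (sizeBound-encodeℕ ∣Q∣) (sizeBound-∙ (sizeBound-encodeFin q⁰)
  (sizeBound-encodeList sizeBound-encodeTransition δ δ≤l))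
  where open NFA A

sizeBound-encodeSubset : ∀ {q} (S : Subset q) → SizeBound (encodeSubset S) (suc (q * 4))
sizeBound-encodeSubset S =
  sizeBound-encodeList {f = encodeBool} (λ { true → ≤-size ℕₚ.≤-refl ; false → ≤-size (s≤s z≤n) })
    (toList S) (ℕₚ.≤-reflexive (Vecₚ.length-toList S))

lcrBound : ℕ → ℕ → ℕ → ℕ
lcrBound n K m =
  1 + (suc (2 * d) + (1 + (suc (2 * d)
    + (1 + (nfaBound d (suc (n + m)) (m * (K * 1) + (n * 1 + 0))
    + (1 + (nfaBound d (suc n) (K * (n * 1) + (n * 1 + 0)) + suc (suc (n + m) * 4))))))))
  where
  d : ℕ
  d = suc (n + K)

sizeBound-coverLCR : ∀ {n K} (S : Fin K → Subset n) m → SizeBound (encodeLCR (coverLCR S m)) (lcrBound n K m)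
sizeBound-coverLCR {n} {K} S m =
  sizeBound-∙ (sizeBound-encodeℕ d) (sizeBound-∙ (sizeBound-encodeFin a⁰)
    (sizeBound-∙ (sizeBound-encodeNFA P-L (length-leaderδ {n} {K} m))
      (sizeBound-∙ (sizeBound-encodeNFA P-C (length-contributorδ S)) (sizeBound-encodeSubset F-L))))
  where open LCRInstance (coverLCR S m)

-- Polynomially bounded functions

module _ {A : Set} (sz : A → ℕ) where

  -- The bound has the shape required by `SolvableInO*`, whose two constants are then read off as
  -- `coeff` and `degree`.
  record IsPoly (f : A → ℕ) : Set where
    constructor mkPoly
    field
      coeff degree : ℕ
      bound        : ∀ x → f x ≤ coeff * suc (sz x) ^ degree

module _ {A : Set} {sz : A → ℕ} where

  poly-const : ∀ m → IsPoly sz (λ _ → m)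
  poly-const m = mkPoly m 0 λ _ → ℕₚ.≤-reflexive (sym (ℕₚ.*-identityʳ m))

  poly-size : IsPoly sz sz
  poly-size = mkPoly 1 1 λ x → ℕₚ.≤-trans (ℕₚ.n≤1+n (sz x))
    (ℕₚ.≤-reflexive (sym (trans (ℕₚ.*-identityˡ _) (ℕₚ.*-identityʳ _))))

  poly-≤ : ∀ {f g} → (∀ x → f x ≤ g x) → IsPoly sz g → IsPoly sz f
  poly-≤ f≤g (mkPoly c k h) = mkPoly c k λ x → ℕₚ.≤-trans (f≤g x) (h x)

  poly-+ : ∀ {f g} → IsPoly sz f → IsPoly sz g → IsPoly sz (λ x → f x + g x)
  poly-+ {f} {g} (mkPoly c k f≤) (mkPoly d l g≤) = mkPoly (c + d) (k + l) λ x → begin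
    f x + g x                                                      ≤⟨ ℕₚ.+-mono-≤ (f≤ x) (g≤ x) ⟩
    c * suc (sz x) ^ k + d * suc (sz x) ^ l                        ≤⟨ ℕₚ.+-mono-≤
        (ℕₚ.*-monoʳ-≤ c (ℕₚ.^-monoʳ-≤ (suc (sz x)) (ℕₚ.m≤m+n k l)))
        (ℕₚ.*-monoʳ-≤ d (ℕₚ.^-monoʳ-≤ (suc (sz x)) (ℕₚ.m≤n+m l k))) ⟩
    c * suc (sz x) ^ (k + l) + d * suc (sz x) ^ (k + l)            ≡⟨ ℕₚ.*-distribʳ-+ _ c d ⟨
    (c + d) * suc (sz x) ^ (k + l)                                 ∎
    where open ℕₚ.≤-Reasoning

  poly-* : ∀ {f g} → IsPoly sz f → IsPoly sz g → IsPoly sz (λ x → f x * g x)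
  poly-* {f} {g} (mkPoly c k f≤) (mkPoly d l g≤) = mkPoly (c * d) (k + l) λ x → begin
    f x * g x                                        ≤⟨ ℕₚ.*-mono-≤ (f≤ x) (g≤ x) ⟩
    (c * suc (sz x) ^ k) * (d * suc (sz x) ^ l)      ≡⟨ rearrange c (suc (sz x) ^ k) d (suc (sz x) ^ l) ⟩
    (c * d) * (suc (sz x) ^ k * suc (sz x) ^ l)      ≡⟨ cong (c * d *_) (ℕₚ.^-distribˡ-+-* (suc (sz x)) k l) ⟨
    (c * d) * suc (sz x) ^ (k + l)                   ∎
    where
    open ℕₚ.≤-Reasoning
    rearrange : ∀ a b c d → (a * b) * (c * d) ≡ (a * c) * (b * d)
    rearrange = solve-∀

  poly-^ : ∀ {f} → IsPoly sz f → ∀ k → IsPoly sz (λ x → f x ^ k)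
  poly-^ p zero    = poly-const 1
  poly-^ p (suc k) = poly-* p (poly-^ p k)

  poly-suc : ∀ {f} → IsPoly sz f → IsPoly sz (λ x → suc (f x))
  poly-suc = poly-+ (poly-const 1)

  poly-loopTime : ∀ {m b} → IsPoly sz m → IsPoly sz b → IsPoly sz (λ x → loopTime (m x) (b x))
  poly-loopTime m b = poly-+ (poly-const 2) (poly-* m (poly-+ (poly-const 2) b))

  poly-nfaBound : ∀ {d q l} → IsPoly sz d → IsPoly sz q → IsPoly sz l → IsPoly sz (λ x → nfaBound (d x) (q x) (l x))
  poly-nfaBound d q l = poly-suc (poly-+ unaryq (poly-suc (poly-+ unaryq (poly-suc (poly-* l (poly-suc
    (poly-suc (poly-+ unaryq (poly-suc (poly-+
      (poly-+ (poly-const 4) (poly-suc (poly-* (poly-const 2) d))) unaryq))))))))))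
    where
    unaryq = poly-suc (poly-* (poly-const 2) q)

n≤size-encodeℕ : ∀ n → n ≤ size (encodeℕ n)
n≤size-encodeℕ zero    = z≤n
n≤size-encodeℕ (suc n) = s≤s (ℕₚ.m≤n⇒m≤1+n (n≤size-encodeℕ n))

length≤size-encodeList : ∀ {A : Set} (f : A → Tree) xs → length xs ≤ size (encodeList f xs)
length≤size-encodeList f []       = z≤n
length≤size-encodeList f (x ∷ xs) = s≤s (ℕₚ.≤-trans (length≤size-encodeList f xs) (ℕₚ.m≤n+m _ (size (f x))))

size≤size-encodeBin : ∀ b → ℕᵇ.size b ≤ size (encodeBin b)
size≤size-encodeBin ℕᵇ.zero  = z≤n
size≤size-encodeBin 2[1+ b ] = s≤s (ℕₚ.m≤n⇒m≤1+n (size≤size-encodeBin b))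
size≤size-encodeBin 1+[2 b ] = s≤s (ℕₚ.≤-trans (size≤size-encodeBin b) (ℕₚ.m≤n+m _ 3))

size-∙ˡ : ∀ s t → size s ≤ size (s ∙ t)
size-∙ˡ s t = ℕₚ.m≤n⇒m≤1+n (ℕₚ.m≤m+n (size s) (size t))

size-∙ʳ : ∀ s t → size t ≤ size (s ∙ t)
size-∙ʳ s t = ℕₚ.m≤n⇒m≤1+n (ℕₚ.m≤n+m (size t) (size s))

Poly : (SetCoverInstance → ℕ) → Set
Poly = IsPoly (size ∘ encodeSetCover)

module _ where
  open SetCoverInstance

  poly-n : Poly n
  poly-n = poly-≤ (λ I → ℕₚ.≤-trans (n≤size-encodeℕ (n I)) (size-∙ˡ (encodeℕ (n I)) (rest I))) poly-size
    where
    rest : SetCoverInstance → Tree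
    rest I = encodeList encodeSubset (ℱ I) ∙ encodeBin (ℕᵇ.fromℕ (r I))

  poly-K : Poly (length ∘ ℱ)
  poly-K = poly-≤ (λ I → let f = encodeList encodeSubset (ℱ I) ; b = encodeBin (ℕᵇ.fromℕ (r I)) in
    ℕₚ.≤-trans (length≤size-encodeList encodeSubset (ℱ I))
      (ℕₚ.≤-trans (size-∙ˡ f b) (size-∙ʳ (encodeℕ (n I)) (f ∙ b)))) poly-size

  poly-digits : Poly (ℕᵇ.size ∘ ℕᵇ.fromℕ ∘ r)
  poly-digits = poly-≤ (λ I → let f = encodeList encodeSubset (ℱ I) ; b = encodeBin (ℕᵇ.fromℕ (r I)) in
    ℕₚ.≤-trans (size≤size-encodeBin (ℕᵇ.fromℕ (r I)))
      (ℕₚ.≤-trans (size-∙ʳ f b) (size-∙ʳ (encodeℕ (n I)) (f ∙ b)))) poly-size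

  poly-stages : Poly stages
  poly-stages = poly-≤ (λ I → capSum≤size (ℕᵇ.fromℕ (r I)) 1 (length (ℱ I)) 0)
    (poly-+ (poly-* poly-digits (poly-* (poly-suc poly-K) (poly-const 2))) (poly-const 0))

  poly-transformTime : Poly transformTime
  poly-transformTime =
    poly-+ (poly-const (straight unpack)) (poly-+ (poly-+ (poly-const 2) (poly-loop poly-K countBody))
    (poly-+ (poly-+ (poly-const 6) (poly-loopTime poly-digits (poly-+ (poly-const 2)
              (poly-+ (poly-loop (poly-suc poly-K) unit) (poly-const 3)))))
    (poly-+ (poly-+ (poly-const 4) (poly-loop poly-n awaitsBody))
    (poly-+ (poly-+ (poly-const 4) (poly-loop poly-n reportsBody))
    (poly-+ (poly-+ (poly-const 2) (poly-loopTime poly-stages (poly-+ (poly-const 2) (poly-+ (poly-const 4)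
              (poly-+ (poly-loop poly-K announceBody) (poly-const 9))))))
    (poly-+ (poly-+ (poly-const 4) (poly-loopTime poly-K (poly-+ (poly-const 3)
              (poly-+ (poly-loop poly-n pickBody) (poly-const 9)))))
    (poly-const (straight output + straight clear))))))))
    where
    poly-loop : ∀ {m} → Poly m → ∀ body → Poly (λ I → loopTime (m I) (straight body))
    poly-loop m body = poly-loopTime m (poly-const (straight body))

  poly-reduce : Poly (size ∘ encodeLCR ∘ reduce)
  poly-reduce = poly-≤ (λ I → size≤ (sizeBound-coverLCR (List.lookup (ℱ I)) (stages I)))
    (poly-suc (poly-+ unaryd (poly-suc (poly-+ unaryd (poly-suc (poly-+
      (poly-nfaBound d (poly-suc (poly-+ poly-n poly-stages))
        (poly-+ (poly-* poly-stages (poly-* poly-K (poly-const 1))) n1))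
      (poly-suc (poly-+
        (poly-nfaBound d (poly-suc poly-n) (poly-+ (poly-* poly-K (poly-* poly-n (poly-const 1))) n1))
        (poly-suc (poly-* (poly-suc (poly-+ poly-n poly-stages)) (poly-const 4)))))))))))
    where
    d = poly-suc (poly-+ poly-n poly-K)
    unaryd = poly-suc (poly-* (poly-const 2) d)
    n1 = poly-+ (poly-* poly-n (poly-const 1)) (poly-const 0)

-- Composing the transformation with a program for LCR

store-nils : ∀ k x → store (List.replicate k nil) x ≡ nil
store-nils zero    x       = refl
store-nils (suc k) zero    = refl
store-nils (suc k) (suc x) = store-nils k x

input≗inputRegs : ∀ t → input t ≗ store (inputRegs t)
input≗inputRegs t zero    = refl
input≗inputRegs t (suc x) = sym (store-nils 11 x)

reduce-correct : ∀ I → ReachesC^f (reduce I) ⇔ HasCover I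
reduce-correct I =
  ⇔-sym (cover⇔cover-cap r ⇔-∘ hasCover⇔cover I) ⇔-∘ reaches⇔cover (List.lookup ℱ) (stages I)
  where open SetCoverInstance I

-- The factor `suc s′` pays for the transformation, the factor 2 for the contributor's initial
-- state.
≤·^-sequence : ∀ {s s′ t m b β n} → β ʳ< 2ℚ → s ≤ s′ → 1 ≤ t → suc s′ * (m * 2) ≤ b →
               t ≤ m · β ^ suc n → (s + t) ≤ b · β ^ n
≤·^-sequence {s} {s′} {t} {m} {b} {β} {n} β<2 s≤s′ 1≤t ≤b t≤ =
  ≤·^-mono {s + t} {suc s′ * t} {suc s′ * (m * 2)} {b} {β} {n} s+t≤ ≤b
    (≤·^-scale {t} {m * 2} {β} {n} (suc s′) (≤·^-pred {t} {m} {β} {n} β<2 t≤))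
  where
  open ℕₚ.≤-Reasoning
  s+t≤ : s + t ≤ suc s′ * t
  s+t≤ = begin
    s + t       ≤⟨ ℕₚ.+-monoˡ-≤ t s≤s′ ⟩
    s′ + t      ≤⟨ ℕₚ.+-monoˡ-≤ t (ℕₚ.m≤m*n s′ t {{ℕ.>-nonZero 1≤t}}) ⟩
    s′ * t + t  ≡⟨ ℕₚ.+-comm (s′ * t) t ⟩
    suc s′ * t  ∎

-- The goal unfolds to `(2ℚ ℚ.- 2ℚ) <ʳ δ`, and the closed difference computes to `0ℚ`.
2⊖δ<2 : ∀ {δ} → 0ℚ <ʳ δ → (2ℚ ⊖ δ) ʳ< 2ℚ
2⊖δ<2 0<δ = 0<δ

proposition17 : (δ : ℝ) → 0ℚ <ʳ δ → SolvableInO* LCR (2ℚ ⊖ δ) → SolvableInO* SetCover (2ℚ ⊖ δ)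
proposition17 δ 0<δ (prog , c , k , solve) =
  (transform ⨾ prog) , IsPoly.coeff totalBound , IsPoly.degree totalBound , decide
  where
  lcrTime : SetCoverInstance → ℕ
  lcrTime I = c * suc (size (encodeLCR (reduce I))) ^ k

  totalBound : Poly (λ I → suc (transformTime I) * (lcrTime I * 2))
  totalBound = poly-* (poly-suc poly-transformTime)
    (poly-* (poly-* (poly-const c) (poly-^ (poly-suc poly-reduce) k)) (poly-const 2))

  decide : ∀ I → ∃[ τ ] ∃[ t ]
    ⟨ transform ⨾ prog , input (encodeSetCover I) ⟩⇓ τ In t
    × (Accepts τ ⇔ HasCover I)
    × t ≤ (IsPoly.coeff totalBound * suc (size (encodeSetCover I)) ^ IsPoly.degree totalBound)
        · (2ℚ ⊖ δ) ^ SetCoverInstance.n I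
  decide I =
    let mkRun {time = s} p p≗ p≤ = run-transform I
        _ , p′ , p≗p′            = ⇓-cong (sym ∘ input≗inputRegs (encodeSetCover I)) p
        _ , t , q , q⇔ , q≤      = solve (reduce I)
        _ , q′ , q≗q′            = ⇓-cong (λ x → trans (input≗inputRegs (encodeLCR (reduce I)) x)
                                                  (trans (sym (p≗ x)) (p≗p′ x))) q
    in _ , s + t , seq p′ q′
     -- Acceptance inspects variable 0 only, so pointwise equality of the final stores is enough.
     , subst (λ a → a ≢ nil ⇔ HasCover I) (q≗q′ 0) (reduce-correct I ⇔-∘ q⇔)
     , ≤·^-sequence {s} {transformTime I} {t} {lcrTime I} {β = 2ℚ ⊖ δ} {SetCoverInstance.n I}
         (2⊖δ<2 {δ} 0<δ) p≤ (⇓-positive q) (IsPoly.bound totalBound I) q≤
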